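{- Let $p$ be an odd prime and let \[ L_p=\langle x_i\ (i\in\mathbb N),\ y_{i,k}\ (i<k)\mid x_i^p,\ [x_i,x_k]y_{i,k}^{ -1}\ (i<k),\ [y_{i,k},x_r]\ (i<k,\ r\in\mathbb N)\rangle, \] the free nilpotent-of-class-$2$ group of exponent $p$ on countably infinitely many generators. Then $L_p$ is not word automatic.
   Context: A group $G$ is word automatic (FA-presentable) if there are a finite alphabet $\Sigma$, a regular set $D\subseteq\Sigma^*$ and a bijection $D\to G$ such that, with respect to the induced operation $\circ$ on $D$, the relation $\{(u,v,w)\in D^3: u\circ v=w\}$ is recognized by a synchronous finite automaton reading the three strings in parallel (shorter strings padded with a blank symbol). -}

module Defs where

open import Data.Nat using (ℕ; zero; suc; _<_; _⊔_)
open import Data.Bool using (Bool; true; false; not)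
open import Data.Fin using (Fin)
open import Data.Maybe using (Maybe; just; nothing)
open import Data.List using (List; []; _∷_; _++_; reverse; map; replicate; length; zipWith; foldl)
open import Data.Product using (_×_; _,_; Σ; ∃)
open import Relation.Binary.PropositionalEquality using (_≡_)

-- a letter is a generator together with a sign (true = g, false = g⁻¹)
Letter : Set → Set
Letter X = X × Bool

Word : Set → Set
Word X = List (Letter X)

invLetter : {X : Set} → Letter X → Letter X
invLetter (g , b) = (g , not b)

invWord : {X : Set} → Word X → Word X
invWord w = reverse (map invLetter w)

data PresEq {X : Set} (R : Word X → Set) : Word X → Word X → Set where
  pe-refl  : ∀ {u} → PresEq R u u
  pe-sym   : ∀ {u v} → PresEq R u v → PresEq R v u
  pe-trans : ∀ {u v w} → PresEq R u v → PresEq R v w → PresEq R u w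
  pe-cong  : ∀ {u u' v v'} → PresEq R u u' → PresEq R v v' →
             PresEq R (u ++ v) (u' ++ v')
  pe-cancel : ∀ (a : Letter X) → PresEq R (a ∷ invLetter a ∷ []) []
  pe-rel   : ∀ {r} → R r → PresEq R r []

data Gen : Set where
  x : ℕ → Gen
  y : (i k : ℕ) → i < k → Gen

gen : Gen → Word Gen
gen g = (g , true) ∷ []

comm : {X : Set} → Word X → Word X → Word X
comm a b = invWord a ++ invWord b ++ a ++ b

data LpRel (p : ℕ) : Word Gen → Set where
  rel-pow  : ∀ i → LpRel p (replicate p (x i , true))
  rel-defy : ∀ i k (i<k : i < k) →
             LpRel p (comm (gen (x i)) (gen (x k)) ++ invWord (gen (y i k i<k)))
  rel-cent : ∀ i k (i<k : i < k) r →
             LpRel p (comm (gen (y i k i<k)) (gen (x r)))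

Lp-Carrier : Set
Lp-Carrier = Word Gen

_≈Lp[_]_ : Word Gen → ℕ → Word Gen → Set
u ≈Lp[ p ] v = PresEq (LpRel p) u v

record DFA (A : Set) : Set where
  field
    nStates : ℕ
    start   : Fin nStates
    δ       : Fin nStates → A → Fin nStates
    accept  : Fin nStates → Bool

accepts : {A : Set} → DFA A → List A → Bool
accepts M w = DFA.accept M (foldl (DFA.δ M) (DFA.start M) w)

pad : {A : Set} → ℕ → List A → List (Maybe A)
pad zero    _        = []
pad (suc n) []       = nothing ∷ pad n []
pad (suc n) (a ∷ as) = just a ∷ pad n as

conv3 : {A : Set} → List A → List A → List A → List (Maybe A × Maybe A × Maybe A)
conv3 u v w =
  let N = length u ⊔ length v ⊔ length w in
  zipWith (λ a bc → (a , bc)) (pad N u) (zipWith _,_ (pad N v) (pad N w))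

record WordAutomatic {G : Set} (_≈_ : G → G → Set) (_∙_ : G → G → G) : Set₁ where
  field
    k     : ℕ
    Dom   : DFA (Fin k)
    rep   : List (Fin k) → G
    rep-surj : ∀ (g : G) → Σ (List (Fin k)) λ u → (accepts Dom u ≡ true) × (rep u ≈ g)
    rep-inj  : ∀ u v → accepts Dom u ≡ true → accepts Dom v ≡ true →
               rep u ≈ rep v → u ≡ v
    Mult  : DFA (Maybe (Fin k) × Maybe (Fin k) × Maybe (Fin k))
    mult-correct : ∀ u v w →
                   (accepts Mult (conv3 u v w) ≡ true →
                      (accepts Dom u ≡ true) × (accepts Dom v ≡ true) ×
                      (accepts Dom w ≡ true) × ((rep u ∙ rep v) ≈ rep w))
                   × ((accepts Dom u ≡ true) → (accepts Dom v ≡ true) →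
                      (accepts Dom w ≡ true) → ((rep u ∙ rep v) ≈ rep w) →
                      accepts Mult (conv3 u v w) ≡ true)

LpWordAutomatic : ℕ → Set₁
LpWordAutomatic p = WordAutomatic (λ u v → u ≈Lp[ p ] v) _++_

{-# OPTIONS --safe #-}
module Submission where

-- In a word automatic group write |g| for the length of the name of g.  Pumping bounds |gh| by
-- max(|g|,|h|) + O(1), so a product of 2^m factors of length at most n has length n + O(m).
-- In L_p the map ψ(u) = [u,x₀] is a homomorphism to the centre with infinite image, and pumping
-- the relation u x₀ = x₀ u t gives, for each n, some u of length n + O(1) with |ψ(u)| > n.
-- Such a u lies outside the span (modulo the kernel of ψ) of any 2^m given elements of length
-- n − O(m).  Hence there are d = 2^m independent elements of length O(d m).  Independence makes
-- 2^(d(d−1)/2) products of their commutators distinct, as coordinates in Heisenberg groups over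
-- ℤ/p detect; but these products have length O(d m) too, so there are only 2^O(d m) of them.

open import Defs
open import Algebra.Bundles using (Group)
import Algebra.Properties.Group as GroupProperties
open import Data.Bool using (Bool; true; false; not)
open import Data.Bool.Properties using (not-involutive)
open import Data.Empty using (⊥)
open import Data.Fin using (Fin; toℕ; combine; quotient; remainder)
  renaming (zero to fzero; suc to fsuc)
open import Data.Fin.Properties
  using (pigeonhole; toℕ<n; toℕ-injective; combine-injective; combine-remQuot; injective⇒≤; ¬∀⟶∃¬)
  renaming (suc-injective to fsuc-injective)
open import Data.Integer using (ℤ; +_; 0ℤ; 1ℤ; _-_; -_)
  renaming (_+_ to _+ᶻ_; _*_ to _*ᶻ_; ∣_∣ to abs)
import Data.Integer.Properties as ℤ
open import Data.Integer.Divisibility.Signed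
  using (divides; ∣ᵤ⇒∣; ∣⇒∣ᵤ; ∣m∣n⇒∣m+n; ∣m⇒∣-m; ∣m⇒∣m*n; ∣n⇒∣m*n) renaming (_∣_ to _∣ᶻ_)
open import Data.Integer.Tactic.RingSolver using (solve-∀)
open import Data.List
  using (List; []; _∷_; [_]; _++_; concat; drop; take; head; map; replicate; length; foldl; foldr; zipWith)
open import Data.List.Membership.Propositional using (_∈_)
open import Data.List.Properties
  using (++-assoc; ++-identityʳ; drop-all; drop-drop; length-++; length-drop; length-replicate;
         length-take; take++drop≡id; unfold-reverse)
open import Data.List.Relation.Unary.All using (All; []; _∷_)
import Data.List.Relation.Unary.All.Properties as All
open import Data.List.Relation.Unary.Any using (here; there)
open import Data.Maybe using (Maybe; just; nothing)
open import Data.Nat using (ℕ; zero; suc; _+_; _*_; _^_; _∸_; _≤_; _<_; _⊔_; _/_; _%_; z≤n; s≤s; nonTrivial⇒n>1)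
open import Data.Nat.Coprimality using (Coprime; coprime-Bézout)
open import Data.Nat.DivMod using (m≡m%n+[m/n]*n; m%n<n)
import Data.Nat.Divisibility as ℕ∣
open import Data.Nat.Divisibility using () renaming (_∣_ to _∣ℕ_; _∣?_ to _∣ℕ?_)
open import Data.Nat.GCD using (module Bézout)
open import Data.Nat.Induction using (<-wellFounded)
open import Data.Nat.Primality using (Prime; ¬prime[0]; euclidsLemma; prime⇒irreducible; prime⇒nonTrivial)
open import Data.Nat.Properties
import Data.Nat.Tactic.RingSolver as ℕRing
open import Data.Product using (_×_; _,_; ∃; ∃₂; map₂; proj₁; proj₂)
open import Data.Sum as Sum using (_⊎_; inj₁; inj₂)
open import Function using (_∘_)
open import Induction.WellFounded using (Acc; acc)
open import Level using (0ℓ)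
open import Relation.Binary.Bundles using (Setoid)
open import Relation.Binary.PropositionalEquality as ≡ using (_≡_; _≢_; refl; cong; cong₂; subst)
import Relation.Binary.Reasoning.Setoid as SetoidReasoning
open import Relation.Nullary using (¬_; yes; no; contradiction)

-- The difficulty is to find short elements that are independent modulo the centre. A count of names
-- alone does not produce them, because the centre is infinite and could a priori take up almost all
-- short names. The map ψ turns independence into a question of length: a product s of boundedly
-- many short elements has a short ψ(s), so an element v with ψ(v) longer than that cannot satisfy
-- ψ(v s) = 1. The threshold for ψ(v) depends only on the earlier elements, so it can be fixed
-- before v is pumped. Independence itself is Gaussian elimination over ℤ/p. The new v is multiplied
-- by powers of the earlier elements until its exponents at their pivots vanish modulo p; since ψ(v
-- s) is still nontrivial, some exponent is nonzero modulo p and becomes the new pivot. At most d p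
-- factors are used, so by the logarithmic product bound each round lengthens the elements by O(m)
-- only, and d rounds by O(d m).

module _ {A : Set} where

  cut : ℕ → ℕ → List A → List A
  cut zero    l u       = drop l u
  cut (suc i) l []      = []
  cut (suc i) l (a ∷ u) = a ∷ cut i l u

  cut-[] : ∀ i l → cut i l [] ≡ []
  cut-[] zero    zero    = refl
  cut-[] zero    (suc l) = refl
  cut-[] (suc i) l       = refl

  head-cut : ∀ i l u → head (cut (suc i) l u) ≡ head u
  head-cut i l []      = refl
  head-cut i l (a ∷ u) = refl

  tail-cut : ∀ i l u → drop 1 (cut (suc i) l u) ≡ cut i l (drop 1 u)
  tail-cut i l []      = ≡.sym (cut-[] i l)
  tail-cut i l (a ∷ u) = refl

  drop-cut : ∀ i l u → drop i (cut i l u) ≡ drop (i + l) u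
  drop-cut zero    l u       = refl
  drop-cut (suc i) l []      = refl
  drop-cut (suc i) l (a ∷ u) = drop-cut i l u

  cut-short : ∀ i l u → length u ≤ i → cut i l u ≡ u
  cut-short zero    l []      _       = cut-[] zero l
  cut-short (suc i) l []      _       = refl
  cut-short (suc i) l (a ∷ u) (s≤s h) = cong (a ∷_) (cut-short i l u h)

  length-cut-≤ : ∀ i l u → length (cut i l u) ≤ length u
  length-cut-≤ zero    l u       = subst (_≤ length u) (≡.sym (length-drop l u)) (m∸n≤m (length u) l)
  length-cut-≤ (suc i) l []      = z≤n
  length-cut-≤ (suc i) l (a ∷ u) = s≤s (length-cut-≤ i l u)

  length-cut-< : ∀ i l u → i < length u → length (cut i (suc l) u) < length u
  length-cut-< zero    l (a ∷ u) _       =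
    s≤s (subst (_≤ length u) (≡.sym (length-drop l u)) (m∸n≤m (length u) l))
  length-cut-< (suc i) l (a ∷ u) (s≤s h) = s≤s (length-cut-< i l u h)

  length-cut-> : ∀ n i l u → n < i → n < length u → n < length (cut i l u)
  length-cut-> zero    (suc i) l (a ∷ u) _       _       = s≤s z≤n
  length-cut-> (suc n) (suc i) l (a ∷ u) (s≤s h) (s≤s k) = s≤s (length-cut-> n i l u h k)

-- The pigeonhole is applied to the `s + 1` positions from `n` to `n + s`. Hence excising the
-- repeated segment leaves words of length at most `n` untouched, while every word longer than
-- `n + s` loses letters.
recurrence : ∀ {s} (f : ℕ → Fin s) n →
             ∃₂ λ i l → n ≤ i × i + suc l ≤ n + s × f i ≡ f (i + suc l)
recurrence {s} f n with pigeonhole (n<1+n s) (λ j → f (n + toℕ j))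
... | j , j' , j<j' , eq =
  n + toℕ j , toℕ j' ∸ suc (toℕ j) , m≤m+n n (toℕ j) ,
  subst (_≤ n + s) (≡.sym gap) (+-monoʳ-≤ n (≤-pred (toℕ<n j'))) ,
  ≡.trans eq (cong f (≡.sym gap))
  where
  gap : n + toℕ j + suc (toℕ j' ∸ suc (toℕ j)) ≡ n + toℕ j'
  gap = ≡.trans (+-assoc n _ _)
       (cong (λ r → n + r) (≡.trans (+-suc (toℕ j) _) (m+[n∸m]≡n j<j')))

-- Runs on padded triples and the excision of a loop.

module Runs {A : Set} (M : DFA (Maybe A × Maybe A × Maybe A)) where
  open DFA M

  -- The blank column leaves the state unchanged, so that one may keep reading past
  -- the end of the longest word.
  step : Fin nStates → Maybe A × Maybe A × Maybe A → Fin nStates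
  step q (nothing , nothing , nothing) = q
  step q c@(just _ , _)                = δ q c
  step q c@(nothing , just _ , _)      = δ q c
  step q c@(nothing , nothing , just _) = δ q c

  run : Fin nStates → ℕ → List A → List A → List A → Fin nStates
  run q zero    u v w = q
  run q (suc n) u v w =
    run (step q (head u , head v , head w)) n (drop 1 u) (drop 1 v) (drop 1 w)

  run-cong : ∀ q n {u u' v v' w w'} → u ≡ u' → v ≡ v' → w ≡ w' →
             run q n u v w ≡ run q n u' v' w'
  run-cong q n refl refl refl = refl

  run-+ : ∀ q i m u v w →
          run q (i + m) u v w ≡ run (run q i u v w) m (drop i u) (drop i v) (drop i w)
  run-+ q zero    m u v w = refl
  run-+ q (suc i) m u v w = ≡.trans (run-+ _ i m _ _ _)
    (run-cong _ m (drop-drop 1 i u) (drop-drop 1 i v) (drop-drop 1 i w))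

  run-cut : ∀ q i l u v w → run q i (cut i l u) (cut i l v) (cut i l w) ≡ run q i u v w
  run-cut q zero    l u v w = refl
  run-cut q (suc i) l u v w
    rewrite head-cut i l u | head-cut i l v | head-cut i l w
          | tail-cut i l u | tail-cut i l v | tail-cut i l w = run-cut _ i l _ _ _

  run-pump : ∀ q i l m u v w → run q i u v w ≡ run q (i + l) u v w →
             run q (i + m) (cut i l u) (cut i l v) (cut i l w) ≡ run q (i + l + m) u v w
  run-pump q i l m u v w same = begin
    run q (i + m) (cut i l u) (cut i l v) (cut i l w)
      ≡⟨ run-+ q i m _ _ _ ⟩
    run (run q i (cut i l u) (cut i l v) (cut i l w)) m _ _ _
      ≡⟨ cong (λ r → run r m _ _ _) (≡.trans (run-cut q i l u v w) same) ⟩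
    run (run q (i + l) u v w) m _ _ _
      ≡⟨ run-cong _ m (drop-cut i l u) (drop-cut i l v) (drop-cut i l w) ⟩
    run (run q (i + l) u v w) m (drop (i + l) u) (drop (i + l) v) (drop (i + l) w)
      ≡⟨ ≡.sym (run-+ q (i + l) m u v w) ⟩
    run q (i + l + m) u v w ∎
    where open ≡.≡-Reasoning

  run-blank : ∀ q n → run q n [] [] [] ≡ q
  run-blank q zero    = refl
  run-blank q (suc n) = run-blank q n

  columns : ℕ → List A → List A → List A → List (Maybe A × Maybe A × Maybe A)
  columns n u v w = zipWith _,_ (pad n u) (zipWith _,_ (pad n v) (pad n w))

  pad-suc : ∀ n (u : List A) → pad (suc n) u ≡ head u ∷ pad n (drop 1 u)
  pad-suc n []      = refl
  pad-suc n (a ∷ u) = refl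

  -- `step` and `δ` can differ only on the all-blank column, which the positive maximum rules out.
  step-δ : ∀ q {n} u v w → suc n ≡ length u ⊔ length v ⊔ length w →
           δ q (head u , head v , head w) ≡ step q (head u , head v , head w)
  step-δ q []      []      []      ()
  step-δ q (_ ∷ _) _       _       _ = refl
  step-δ q []      (_ ∷ _) _       _ = refl
  step-δ q []      []      (_ ∷ _) _ = refl

  tails-max : ∀ {n} (u v w : List A) → suc n ≡ length u ⊔ length v ⊔ length w →
              n ≡ length (drop 1 u) ⊔ length (drop 1 v) ⊔ length (drop 1 w)
  tails-max u v w eq
    rewrite length-drop 1 u | length-drop 1 v | length-drop 1 w =
    ≡.trans (cong (_∸ 1) eq)
    (≡.trans (mono-≤-distrib-⊔ mono (length u ⊔ length v) (length w))
           (cong (_⊔ (length w ∸ 1)) (mono-≤-distrib-⊔ mono (length u) (length v))))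
    where
    mono : ∀ {m n} → m ≤ n → m ∸ 1 ≤ n ∸ 1
    mono = ∸-monoˡ-≤ 1

  foldl-columns : ∀ q n u v w → n ≡ length u ⊔ length v ⊔ length w →
                  foldl δ q (columns n u v w) ≡ run q n u v w
  foldl-columns q zero    u v w eq = refl
  foldl-columns q (suc n) u v w eq
    rewrite pad-suc n u | pad-suc n v | pad-suc n w | step-δ q u v w eq =
    foldl-columns _ n (drop 1 u) (drop 1 v) (drop 1 w) (tails-max u v w eq)

  -- Any upper bound `n` will do, since steps past the longest word read blank columns. This spares
  -- the computation of the exact maximum after an excision.
  accepts-run : ∀ n u v w → length u ≤ n → length v ≤ n → length w ≤ n →
                accepts M (conv3 u v w) ≡ accept (run start n u v w)
  accepts-run n u v w u≤n v≤n w≤n = cong accept (begin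
    foldl δ start (conv3 u v w)  ≡⟨ foldl-columns start N u v w refl ⟩
    run start N u v w            ≡⟨ ≡.sym (run-blank _ (n ∸ N)) ⟩
    run (run start N u v w) (n ∸ N) [] [] []
      ≡⟨ run-cong _ (n ∸ N) (≡.sym (drop-all N u u≤N)) (≡.sym (drop-all N v v≤N)) (≡.sym (drop-all N w w≤N)) ⟩
    run (run start N u v w) (n ∸ N) (drop N u) (drop N v) (drop N w)
      ≡⟨ ≡.sym (run-+ start N (n ∸ N) u v w) ⟩
    run start (N + (n ∸ N)) u v w
      ≡⟨ cong (λ r → run start r u v w) (m+[n∸m]≡n (⊔-lub (⊔-lub u≤n v≤n) w≤n)) ⟩
    run start n u v w ∎)
    where
    open ≡.≡-Reasoning
    N = length u ⊔ length v ⊔ length w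
    w≤N : length w ≤ N
    w≤N = m≤n⊔m (length u ⊔ length v) (length w)
    u≤N : length u ≤ N
    u≤N = m≤n⇒m≤n⊔o (length w) (m≤m⊔n (length u) (length v))
    v≤N : length v ≤ N
    v≤N = m≤n⇒m≤n⊔o (length w) (m≤n⊔m (length u) (length v))

  -- All three words are cut at the same positions, so their columns stay aligned and the run is
  -- spliced at the repeated state. The loop may lie beyond the ends of some of the words.
  accepts-cut : ∀ i l u v w → run start i u v w ≡ run start (i + l) u v w →
                accepts M (conv3 u v w) ≡ true →
                accepts M (conv3 (cut i l u) (cut i l v) (cut i l w)) ≡ true
  accepts-cut i l u v w same accepted = begin
    accepts M (conv3 (cut i l u) (cut i l v) (cut i l w))
      ≡⟨ accepts-run (i + m) _ _ _ (short u u≤m) (short v v≤m) (short w w≤m) ⟩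
    accept (run start (i + m) (cut i l u) (cut i l v) (cut i l w))
      ≡⟨ cong accept (run-pump start i l m u v w same) ⟩
    accept (run start (i + l + m) u v w)
      ≡⟨ ≡.sym (accepts-run (i + l + m) u v w (m≤n⇒m≤o+n (i + l) u≤m)
               (m≤n⇒m≤o+n (i + l) v≤m) (m≤n⇒m≤o+n (i + l) w≤m)) ⟩
    accepts M (conv3 u v w) ≡⟨ accepted ⟩
    true ∎
    where
    open ≡.≡-Reasoning
    m = length u + length v + length w
    w≤m : length w ≤ m
    w≤m = m≤n+m (length w) _
    u≤m : length u ≤ m
    u≤m = m≤n⇒m≤n+o (length w) (m≤m+n (length u) (length v))
    v≤m : length v ≤ m
    v≤m = m≤n⇒m≤n+o (length w) (m≤n+m (length v) (length u))
    short : ∀ z → length z ≤ m → length (cut i l z) ≤ i + m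
    short z z≤m = m≤n⇒m≤o+n i (≤-trans (length-cut-≤ i l z) z≤m)

-- Counting strings of bounded length.

letterAt : ∀ {k} → List (Fin k) → ℕ → Fin (suc k)
letterAt []      _       = fzero
letterAt (a ∷ u) zero    = fsuc a
letterAt (a ∷ u) (suc i) = letterAt u i

-- The extra digit `fzero` is a blank, so that strings of all lengths up to `n` become `n` digits in
-- base `k + 1`.
encode : ∀ {k} n → List (Fin k) → Fin (suc k ^ n)
encode zero    u = fzero
encode (suc n) u = combine (letterAt u 0) (encode n (drop 1 u))

encode-injective : ∀ {k} n (u v : List (Fin k)) → length u ≤ n → length v ≤ n →
                   encode n u ≡ encode n v → u ≡ v
encode-injective zero    []      []      _ _ _ = refl
encode-injective (suc n) u v u≤n v≤n eq
  with combine-injective (letterAt u 0) (encode n (drop 1 u)) (letterAt v 0) (encode n (drop 1 v)) eq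
encode-injective (suc n) []      []      u≤n v≤n eq | _ = refl
encode-injective (suc n) (a ∷ u) (b ∷ v) (s≤s u≤n) (s≤s v≤n) eq | a≡b , rest =
  ≡.cong₂ _∷_ (fsuc-injective a≡b) (encode-injective n u v u≤n v≤n rest)

-- Lengths of names in a word automatic group.

module Automatic (G : Group 0ℓ 0ℓ) (W : WordAutomatic (Group._≈_ G) (Group._∙_ G)) where
  open Group G renaming (refl to ≈-refl; sym to ≈-sym; trans to ≈-trans)
  open GroupProperties G
  open WordAutomatic W
  open Runs Mult

  private
    S = DFA.nStates Mult
    Str = List (Fin k)

  InDom : Str → Set
  InDom u = accepts Dom u ≡ true

  Prod : Str → Str → Str → Set
  Prod u v w = accepts Mult (conv3 u v w) ≡ true

  prod⁻ : ∀ u v w → Prod u v w → rep u ∙ rep v ≈ rep w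
  prod⁻ u v w h = proj₂ (proj₂ (proj₂ (proj₁ (mult-correct u v w) h)))

  prod-dom : ∀ u v w → Prod u v w → InDom u × InDom v × InDom w
  prod-dom u v w h with proj₁ (mult-correct u v w) h
  ... | a , b , c , _ = a , b , c

  name : Carrier → Str
  name g = proj₁ (rep-surj g)

  name-dom : ∀ g → InDom (name g)
  name-dom g = proj₁ (proj₂ (rep-surj g))

  rep-name : ∀ g → rep (name g) ≈ g
  rep-name g = proj₂ (proj₂ (rep-surj g))

  prod⁺ : ∀ g h j → g ∙ h ≈ j → Prod (name g) (name h) (name j)
  prod⁺ g h j eq = proj₂ (mult-correct _ _ _) (name-dom g) (name-dom h) (name-dom j)
    (≈-trans (∙-cong (rep-name g) (rep-name h)) (≈-trans eq (≈-sym (rep-name j))))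

  name-rep : ∀ u → InDom u → name (rep u) ≡ u
  name-rep u u∈D = rep-inj _ _ (name-dom _) u∈D (rep-name (rep u))

  name-cong : ∀ {g h} → g ≈ h → name g ≡ name h
  name-cong eq = rep-inj _ _ (name-dom _) (name-dom _)
    (≈-trans (rep-name _) (≈-trans eq (≈-sym (rep-name _))))

  name-injective : ∀ {g h} → name g ≡ name h → g ≈ h
  name-injective {g} {h} eq =
    ≈-trans (≈-sym (rep-name g)) (≈-trans (reflexive (cong rep eq)) (rep-name h))

  ∣_∣ : Carrier → ℕ
  ∣ g ∣ = length (name g)

  ∣∣-cong : ∀ {g h} → g ≈ h → ∣ g ∣ ≡ ∣ h ∣
  ∣∣-cong eq = cong length (name-cong eq)

  -- If the name v of the quotient were too long, cutting it beyond the ends of u and w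
  -- would yield a second solution of u ∘ v = w.
  ∣∣-ldiv : ∀ {n} g h → ∣ g ∣ ≤ n → ∣ h ∣ ≤ n → ∣ g ⁻¹ ∙ h ∣ ≤ n + S
  ∣∣-ldiv {n} g h g≤n h≤n with ∣ g ⁻¹ ∙ h ∣ ≤? n + S
  ... | yes short = short
  ... | no long with recurrence (λ i → run (DFA.start Mult) i (name g) (name (g ⁻¹ ∙ h)) (name h)) n
  ... | i , l , n≤i , i+l≤n+S , same =
    contradiction (cong length cut≡v) (<⇒≢ (length-cut-< i l v i<v))
    where
    u = name g
    v = name (g ⁻¹ ∙ h)
    w = name h
    i<v : i < length v
    i<v = ≤-trans (m≤n⇒m≤o+n 0 (≤-trans (≤-reflexive (+-comm 1 i)) (+-monoʳ-≤ i (s≤s z≤n))))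
                  (≤-trans i+l≤n+S (<⇒≤ (≰⇒> long)))
    uvw : Prod u v w
    uvw = prod⁺ g (g ⁻¹ ∙ h) h (\\-leftDividesˡ g h)
    uv'w : Prod u (cut i (suc l) v) w
    uv'w = ≡.subst₂ (λ a b → Prod a (cut i (suc l) v) b)
      (cut-short i (suc l) u (≤-trans g≤n n≤i)) (cut-short i (suc l) w (≤-trans h≤n n≤i))
      (accepts-cut i (suc l) u v w same uvw)
    cut≡v : cut i (suc l) v ≡ v
    cut≡v = rep-inj _ _ (proj₁ (proj₂ (prod-dom u _ w uv'w))) (name-dom _)
      (∙-cancelˡ (rep u) _ _ (≈-trans (prod⁻ u _ w uv'w) (≈-sym (prod⁻ u v w uvw))))

  -- `C` is the cost of a product, obtained as (g⁻¹)⁻¹ h by two left divisions of cost `S` each. `K`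
  -- is the cost of pumping three runs at once: `S * (S * S)` triples of states, and one more
  -- because the pigeonhole starts at `suc n`.
  C = S + S
  K = suc (S * (S * S))

  module _ {n} (ε≤n : ∣ ε ∣ ≤ n) where

    ∣∣-inv : ∀ g → ∣ g ∣ ≤ n → ∣ g ⁻¹ ∣ ≤ n + S
    ∣∣-inv g g≤n = subst (_≤ n + S) (∣∣-cong (identityʳ (g ⁻¹))) (∣∣-ldiv g ε g≤n ε≤n)

    ∣∣-∙ : ∀ g h → ∣ g ∣ ≤ n → ∣ h ∣ ≤ n → ∣ g ∙ h ∣ ≤ n + C
    ∣∣-∙ g h g≤n h≤n = subst (_≤ n + C) (∣∣-cong (∙-congʳ (⁻¹-involutive g)))
      (subst (∣ (g ⁻¹) ⁻¹ ∙ h ∣ ≤_) (+-assoc n S S)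
        (∣∣-ldiv (g ⁻¹) h (∣∣-inv g g≤n) (m≤n⇒m≤n+o S h≤n)))

  private
    ∏ : List Carrier → Carrier
    ∏ = foldr _∙_ ε

  ∏-++ : ∀ gs hs → ∏ (gs ++ hs) ≈ ∏ gs ∙ ∏ hs
  ∏-++ []       hs = ≈-sym (identityˡ _)
  ∏-++ (g ∷ gs) hs = ≈-trans (∙-congˡ (∏-++ gs hs)) (≈-sym (assoc g _ _))

  -- Multiplying along a balanced binary tree costs only a logarithmic increase in length.
  ∣∣-∏ : ∀ {n} → ∣ ε ∣ ≤ n → ∀ m gs → length gs ≤ 2 ^ m → All (λ g → ∣ g ∣ ≤ n) gs →
         ∣ ∏ gs ∣ ≤ n + m * C
  ∣∣-∏ {n} ε≤n m [] _ _ = m≤n⇒m≤n+o (m * C) ε≤n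
  ∣∣-∏ {n} ε≤n zero (g ∷ []) _ (g≤n ∷ []) =
    ≤-trans (≤-reflexive (∣∣-cong (identityʳ g))) (m≤n⇒m≤n+o 0 g≤n)
  ∣∣-∏ {n} ε≤n zero (_ ∷ _ ∷ _) (s≤s ()) _
  ∣∣-∏ {n} ε≤n (suc m) gs@(_ ∷ _) len gs≤n = begin
    ∣ ∏ gs ∣              ≡⟨ cong (∣_∣ ∘ ∏) (≡.sym (take++drop≡id (2 ^ m) gs)) ⟩
    ∣ ∏ (ls ++ rs) ∣      ≡⟨ ∣∣-cong (∏-++ ls rs) ⟩
    ∣ ∏ ls ∙ ∏ rs ∣       ≤⟨ ∣∣-∙ (m≤n⇒m≤n+o (m * C) ε≤n) (∏ ls) (∏ rs)
                               (∣∣-∏ ε≤n m ls ls-len (All.take⁺ (2 ^ m) gs≤n))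
                               (∣∣-∏ ε≤n m rs rs-len (All.drop⁺ (2 ^ m) gs≤n)) ⟩
    n + m * C + C       ≡⟨ +-assoc n (m * C) C ⟩
    n + (m * C + C)     ≡⟨ cong (λ r → n + r) (+-comm (m * C) C) ⟩
    n + suc m * C ∎
    where
    open ≤-Reasoning
    ls = take (2 ^ m) gs
    rs = drop (2 ^ m) gs
    ls-len : length ls ≤ 2 ^ m
    ls-len = ≤-trans (≤-reflexive (length-take (2 ^ m) gs)) (m⊓n≤m (2 ^ m) _)
    rs-len : length rs ≤ 2 ^ m
    rs-len = begin
      length rs             ≡⟨ length-drop (2 ^ m) gs ⟩
      length gs ∸ 2 ^ m     ≤⟨ ∸-monoˡ-≤ (2 ^ m) len ⟩
      2 ^ m + (2 ^ m + 0) ∸ 2 ^ m ≡⟨ m+n∸m≡n (2 ^ m) _ ⟩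
      2 ^ m + 0             ≡⟨ +-identityʳ _ ⟩
      2 ^ m ∎

  -- `c` is the left quotient of g h by h g: two products of length at most `n + C`, then one
  -- division, whose cost `S` is rounded up to `C`.
  ∣∣-comm : ∀ {n} → ∣ ε ∣ ≤ n → ∀ g h c → g ∙ h ≈ h ∙ g ∙ c → ∣ g ∣ ≤ n → ∣ h ∣ ≤ n →
            ∣ c ∣ ≤ n + (C + C)
  ∣∣-comm {n} ε≤n g h c eq g≤n h≤n = begin
    ∣ c ∣                       ≡⟨ ∣∣-cong (≈-sym c≈) ⟩
    ∣ (h ∙ g) ⁻¹ ∙ (g ∙ h) ∣    ≤⟨ ∣∣-ldiv (h ∙ g) (g ∙ h) (∣∣-∙ ε≤n h g h≤n g≤n) (∣∣-∙ ε≤n g h g≤n h≤n) ⟩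
    n + C + S                   ≤⟨ +-monoʳ-≤ (n + C) (m≤m+n S S) ⟩
    n + C + C                   ≡⟨ +-assoc n C C ⟩
    n + (C + C) ∎
    where
    open ≤-Reasoning
    c≈ : (h ∙ g) ⁻¹ ∙ (g ∙ h) ≈ c
    c≈ = ≈-trans (∙-congˡ eq) (\\-leftDividesʳ (h ∙ g) c)

  counting : ∀ {n N} (f : Fin N → Carrier) → (∀ i → ∣ f i ∣ ≤ n) →
             (∀ {i j} → f i ≈ f j → i ≡ j) → N ≤ suc k ^ n
  counting {n} f f≤n f-inj = injective⇒≤ {f = encode n ∘ name ∘ f} λ {i} {j} eq →
    f-inj (name-injective (encode-injective n _ _ (f≤n i) (f≤n j) eq))

  -- The strings v and t name an element and its commutator with g; cutting both of them, and the
  -- names of the two products, beyond position n shortens v but leaves t longer than n.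
  module _ (g : Carrier) {n} (g≤n : ∣ g ∣ ≤ n) where
    private
      x₀ = name g
      start = DFA.start Mult

    shorten : ∀ (v w z t : Str) → Prod v x₀ z → Prod x₀ v w → Prod w t z → n < length t →
              Acc _<_ (length v) →
              ∃₂ λ v′ t′ → InDom v′ × InDom t′ × rep v′ ∙ g ≈ g ∙ rep v′ ∙ rep t′ ×
                           length v′ ≤ n + K × n < length t′
    shorten v w z t vx xv wt n<t (acc rec) with length v ≤? n + K
    ... | yes v≤ = v , t , proj₁ (prod-dom v x₀ z vx) , proj₁ (proj₂ (prod-dom w t z wt)) , eq , v≤ , n<t
      where
      eq : rep v ∙ g ≈ g ∙ rep v ∙ rep t
      eq = ≈-trans (∙-congˡ (≈-sym (rep-name g)))
          (≈-trans (prod⁻ v x₀ z vx)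
          (≈-trans (≈-sym (prod⁻ w t z wt))
                   (∙-congʳ (≈-trans (≈-sym (prod⁻ x₀ v w xv)) (∙-congʳ (rep-name g))))))
    -- The three states are packed into one, so that a single loop serves all three relations.
    -- Starting at `suc n` makes `i > n`, which leaves `x₀` intact and keeps the cut `t` longer than
    -- `n`.
    ... | no v≰ with recurrence (λ i → combine (run start i v x₀ z)
                                        (combine (run start i x₀ v w) (run start i w t z))) (suc n)
    ... | i , l , n<i , i+l≤ , same
      with combine-injective (run start i v x₀ z) _ (run start (i + suc l) v x₀ z) _ same
    ... | same₁ , same′
      with combine-injective (run start i x₀ v w) _ (run start (i + suc l) x₀ v w) _ same′
    ... | same₂ , same₃ =
      shorten (c v) (c w) (c z) (c t)
        (subst (λ s → Prod (c v) s (c z)) x₀-short (accepts-cut i (suc l) v x₀ z same₁ vx))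
        (subst (λ s → Prod s (c v) (c w)) x₀-short (accepts-cut i (suc l) x₀ v w same₂ xv))
        (accepts-cut i (suc l) w t z same₃ wt)
        (length-cut-> n i (suc l) t n<i n<t)
        (rec (length-cut-< i l v i<v))
      where
      c = cut i (suc l)
      x₀-short : c x₀ ≡ x₀
      x₀-short = cut-short i (suc l) x₀ (≤-trans g≤n (<⇒≤ n<i))
      i<v : i < length v
      i<v = ≤-trans (≤-trans (≤-reflexive (+-comm 1 i)) (+-monoʳ-≤ i (s≤s z≤n)))
           (≤-trans i+l≤ (≤-trans (≤-reflexive (≡.sym (+-suc n _))) (<⇒≤ (≰⇒> v≰))))

    commutator-pump : ∀ v t → v ∙ g ≈ g ∙ v ∙ t → n < ∣ t ∣ →
                      ∃₂ λ v′ t′ → v′ ∙ g ≈ g ∙ v′ ∙ t′ × ∣ v′ ∣ ≤ n + K × n < ∣ t′ ∣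
    commutator-pump v t eq n<t
      with shorten (name v) (name (g ∙ v)) (name (v ∙ g)) (name t)
             (prod⁺ v g (v ∙ g) ≈-refl) (prod⁺ g v (g ∙ v) ≈-refl)
             (prod⁺ (g ∙ v) t (v ∙ g) (≈-sym eq)) n<t (<-wellFounded _)
    ... | v′ , t′ , v′∈D , t′∈D , eq′ , v′≤ , n<t′ =
      rep v′ , rep t′ , eq′ ,
      subst (_≤ n + K) (cong length (≡.sym (name-rep v′ v′∈D))) v′≤ ,
      subst (n <_) (cong length (≡.sym (name-rep t′ t′∈D))) n<t′

-- Presented groups and commuting elements.

replicate-+ : ∀ {A : Set} m n {a : A} → replicate m a ++ replicate n a ≡ replicate (m + n) a
replicate-+ zero    n = refl
replicate-+ (suc m) n = cong (_ ∷_) (replicate-+ m n)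

module PresentedGroup {X : Set} (R : Word X → Set) where

  infix 4 _≈_
  _≈_ : Word X → Word X → Set
  _≈_ = PresEq R

  ≡⇒≈ : ∀ {u v} → u ≡ v → u ≈ v
  ≡⇒≈ refl = pe-refl

  ++-congˡ : ∀ u {v v′} → v ≈ v′ → u ++ v ≈ u ++ v′
  ++-congˡ u = pe-cong pe-refl

  ++-congʳ : ∀ {u u′} v → u ≈ u′ → u ++ v ≈ u′ ++ v
  ++-congʳ v eq = pe-cong eq pe-refl

  invWord-∷ : ∀ a (u : Word X) → invWord (a ∷ u) ≡ invWord u ++ [ invLetter a ]
  invWord-∷ a u = unfold-reverse (invLetter a) (map invLetter u)

  cancel-inv : ∀ (a : Letter X) → invLetter a ∷ a ∷ [] ≈ []
  cancel-inv (g , b) =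
    subst (λ b′ → (g , not b) ∷ (g , b′) ∷ [] ≈ []) (not-involutive b) (pe-cancel (g , not b))

  inverseˡ : ∀ u → invWord u ++ u ≈ []
  inverseˡ []      = pe-refl
  inverseˡ (a ∷ u) = pe-trans (≡⇒≈ (≡.trans (cong (_++ a ∷ u) (invWord-∷ a u)) (++-assoc (invWord u) _ _)))
    (pe-trans (++-congˡ (invWord u) (++-congʳ u (cancel-inv a))) (inverseˡ u))

  inverseʳ : ∀ u → u ++ invWord u ≈ []
  inverseʳ []      = pe-refl
  inverseʳ (a ∷ u) = pe-trans
    (≡⇒≈ (cong (a ∷_) (≡.trans (cong (u ++_) (invWord-∷ a u)) (≡.sym (++-assoc u (invWord u) _)))))
    (pe-trans (++-congˡ [ a ] (++-congʳ [ invLetter a ] (inverseʳ u))) (pe-cancel a))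

  invWord-cong : ∀ {u v} → u ≈ v → invWord u ≈ invWord v
  invWord-cong {u} {v} eq =
    pe-trans (≡⇒≈ (≡.sym (++-identityʳ _)))
    (pe-trans (++-congˡ (invWord u) (pe-sym (inverseʳ v)))
    (pe-trans (≡⇒≈ (≡.sym (++-assoc (invWord u) v _)))
    (++-congʳ (invWord v) (pe-trans (++-congˡ (invWord u) (pe-sym eq)) (inverseˡ u)))))

  group : Group 0ℓ 0ℓ
  group = record
    { Carrier = Word X ; _≈_ = _≈_ ; _∙_ = _++_ ; ε = [] ; _⁻¹ = invWord
    ; isGroup = record
      { isMonoid = record
        { isSemigroup = record
          { isMagma = record
            { isEquivalence = record { refl = pe-refl ; sym = pe-sym ; trans = pe-trans }
            ; ∙-cong = pe-cong }
          ; assoc = λ u v w → ≡⇒≈ (++-assoc u v w) }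
        ; identity = (λ u → pe-refl) , (λ u → ≡⇒≈ (++-identityʳ u)) }
      ; inverse = inverseˡ , inverseʳ
      ; ⁻¹-cong = invWord-cong } }

module Commuting (G : Group 0ℓ 0ℓ) where
  open Group G
  open GroupProperties G
  open SetoidReasoning setoid

  Commutes : Carrier → Carrier → Set
  Commutes g h = g ∙ h ≈ h ∙ g

  commutes-sym : ∀ {g h} → Commutes g h → Commutes h g
  commutes-sym = sym

  commutes-ε : ∀ g → Commutes g ε
  commutes-ε g = trans (identityʳ g) (sym (identityˡ g))

  commutes-cong : ∀ {g h h′} → h ≈ h′ → Commutes g h → Commutes g h′
  commutes-cong eq c = trans (∙-congˡ (sym eq)) (trans c (∙-congʳ eq))

  commutes-∙ : ∀ {g h j} → Commutes g h → Commutes g j → Commutes g (h ∙ j)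
  commutes-∙ {g} {h} {j} c d = begin
    g ∙ (h ∙ j) ≈⟨ assoc g h j ⟨
    g ∙ h ∙ j   ≈⟨ ∙-congʳ c ⟩
    h ∙ g ∙ j   ≈⟨ assoc h g j ⟩
    h ∙ (g ∙ j) ≈⟨ ∙-congˡ d ⟩
    h ∙ (j ∙ g) ≈⟨ assoc h j g ⟨
    h ∙ j ∙ g   ∎

  commutes-⁻¹ : ∀ {g h} → Commutes g h → Commutes g (h ⁻¹)
  commutes-⁻¹ {g} {h} c = ∙-cancelˡ h _ _ (begin
    h ∙ (g ∙ h ⁻¹) ≈⟨ assoc h g _ ⟨
    h ∙ g ∙ h ⁻¹   ≈⟨ ∙-congʳ c ⟨
    g ∙ h ∙ h ⁻¹   ≈⟨ //-rightDividesʳ h g ⟩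
    g              ≈⟨ \\-leftDividesˡ h g ⟨
    h ∙ (h ⁻¹ ∙ g) ∎)

  commutator : ∀ g h → g ∙ h ≈ h ∙ g ∙ (g ⁻¹ ∙ (h ⁻¹ ∙ (g ∙ h)))
  commutator g h = sym (begin
    h ∙ g ∙ (g ⁻¹ ∙ (h ⁻¹ ∙ (g ∙ h)))   ≈⟨ assoc h g _ ⟩
    h ∙ (g ∙ (g ⁻¹ ∙ (h ⁻¹ ∙ (g ∙ h)))) ≈⟨ ∙-congˡ (\\-leftDividesˡ g _) ⟩
    h ∙ (h ⁻¹ ∙ (g ∙ h))                ≈⟨ \\-leftDividesˡ h _ ⟩
    g ∙ h                               ∎)

-- Commutators with x₀ in L_p.

module Lp (p′ : ℕ) where
  p = suc p′
  open PresentedGroup (LpRel p) public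
  open Commuting group public
  open GroupProperties group using (∙-cancelˡ; //-rightDividesʳ; \\-leftDividesˡ)
  open SetoidReasoning (Group.setoid group)

  -- The relators make y_{i,k} commute with the x's only. It commutes with every other y because
  -- that y equals a commutator of two x's.
  central-y : ∀ i k (i<k : i < k) u → Commutes (gen (y i k i<k)) u
  central-y i k i<k = word
    where
    z = gen (y i k i<k)
    gen-x : ∀ r → Commutes z (gen (x r))
    gen-x r = begin
      z ++ gen (x r)                               ≈⟨ commutator z (gen (x r)) ⟩
      (gen (x r) ++ z) ++ comm z (gen (x r))       ≈⟨ ++-congˡ (gen (x r) ++ z) (pe-rel (rel-cent i k i<k r)) ⟩
      (gen (x r) ++ z) ++ []                       ∎
    gen-y : ∀ j l j<l → Commutes z (gen (y j l j<l))
    gen-y j l j<l = commutes-cong comm≈y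
      (commutes-∙ {h = invWord a} (commutes-⁻¹ {h = a} (gen-x j))
      (commutes-∙ {h = invWord b} (commutes-⁻¹ {h = b} (gen-x l))
      (commutes-∙ {h = a} {j = b} (gen-x j) (gen-x l))))
      where
      a = gen (x j)
      b = gen (x l)
      w = gen (y j l j<l)
      comm≈y : comm a b ≈ w
      comm≈y = begin
        comm a b                     ≈⟨ ++-congˡ (comm a b) (inverseˡ w) ⟨
        comm a b ++ invWord w ++ w   ≈⟨ ++-congʳ w (pe-rel (rel-defy j l j<l)) ⟩
        w                            ∎
    generator : ∀ g → Commutes z (gen g)
    generator (x r)       = gen-x r
    generator (y j l j<l) = gen-y j l j<l
    letter : ∀ a → Commutes z [ a ]
    letter (g , true)  = generator g
    letter (g , false) = commutes-⁻¹ {h = gen g} (generator g)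
    word : ∀ u → Commutes z u
    word []      = commutes-ε z
    word (a ∷ u) = commutes-∙ {h = [ a ]} {j = u} (letter a) (word u)

  x₀ : Word Gen
  x₀ = gen (x 0)

  -- The letter is inverse because the relator gives y_{0,i+1} = [x₀,x_{i+1}], while ψ takes
  -- commutators in the opposite order.
  Y : ℕ → Letter Gen
  Y i = y 0 (suc i) (s≤s z≤n) , false

  -- the commutator [u , x₀]; it is central, hence multiplicative in u
  ψ : Word Gen → Word Gen
  ψ []                        = []
  ψ ((x zero , b) ∷ u)        = ψ u
  ψ ((x (suc i) , true) ∷ u)  = Y i ∷ ψ u
  ψ ((x (suc i) , false) ∷ u) = invLetter (Y i) ∷ ψ u
  ψ ((y i k _ , b) ∷ u)       = ψ u

  ψ-++ : ∀ u v → ψ (u ++ v) ≡ ψ u ++ ψ v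
  ψ-++ []                        v = refl
  ψ-++ ((x zero , b) ∷ u)        v = ψ-++ u v
  ψ-++ ((x (suc i) , true) ∷ u)  v = cong (_ ∷_) (ψ-++ u v)
  ψ-++ ((x (suc i) , false) ∷ u) v = cong (_ ∷_) (ψ-++ u v)
  ψ-++ ((y i k _ , b) ∷ u)       v = ψ-++ u v

  central-Y : ∀ i u → Commutes [ Y i ] u
  central-Y i u = commutes-sym {u} (commutes-⁻¹ {h = z} (commutes-sym {z} (central-y 0 (suc i) _ u)))
    where z = gen (y 0 (suc i) (s≤s z≤n))

  x-commutator : ∀ i → gen (x (suc i)) ++ x₀ ≈ x₀ ++ gen (x (suc i)) ++ [ Y i ]
  x-commutator i = begin
    b ++ x₀                               ≈⟨ //-rightDividesʳ z (b ++ x₀) ⟨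
    ((b ++ x₀) ++ z) ++ invWord z         ≈⟨ ++-congʳ (invWord z) (pe-sym x₀b) ⟩
    (x₀ ++ b) ++ invWord z                ∎
    where
    b = gen (x (suc i))
    z = gen (y 0 (suc i) (s≤s z≤n))
    comm≈z : comm x₀ b ≈ z
    comm≈z = begin
      comm x₀ b                     ≈⟨ ++-congˡ (comm x₀ b) (inverseˡ z) ⟨
      comm x₀ b ++ invWord z ++ z   ≈⟨ ++-congʳ z (pe-rel (rel-defy 0 (suc i) (s≤s z≤n))) ⟩
      z                             ∎
    x₀b : x₀ ++ b ≈ (b ++ x₀) ++ z
    x₀b = pe-trans (commutator x₀ b) (++-congˡ (b ++ x₀) comm≈z)

  inverse-commutator : ∀ a z → (∀ u → Commutes z u) → a ++ x₀ ≈ x₀ ++ a ++ z →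
                       invWord a ++ x₀ ≈ x₀ ++ invWord a ++ invWord z
  inverse-commutator a z cz eq = ∙-cancelˡ a _ _ (begin
    a ++ invWord a ++ x₀                     ≈⟨ \\-leftDividesˡ a x₀ ⟩
    x₀                                       ≈⟨ Group.identityʳ group x₀ ⟨
    x₀ ++ []                                 ≈⟨ ++-congˡ x₀ azaz ⟨
    x₀ ++ (a ++ z) ++ invWord a ++ invWord z ≈⟨ ≡⇒≈ (++-assoc x₀ (a ++ z) _) ⟨
    (x₀ ++ a ++ z) ++ invWord a ++ invWord z ≈⟨ ++-congʳ (invWord a ++ invWord z) eq ⟨
    (a ++ x₀) ++ invWord a ++ invWord z      ≈⟨ ≡⇒≈ (++-assoc a x₀ _) ⟩
    a ++ x₀ ++ invWord a ++ invWord z        ∎)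
    where
    azaz : (a ++ z) ++ invWord a ++ invWord z ≈ []
    azaz = begin
      (a ++ z) ++ invWord a ++ invWord z   ≈⟨ ≡⇒≈ (++-assoc a z _) ⟩
      a ++ z ++ invWord a ++ invWord z     ≈⟨ ++-congˡ a (≡⇒≈ (≡.sym (++-assoc z (invWord a) _))) ⟩
      a ++ (z ++ invWord a) ++ invWord z   ≈⟨ ++-congˡ a (++-congʳ (invWord z) (cz (invWord a))) ⟩
      a ++ (invWord a ++ z) ++ invWord z   ≈⟨ ++-congˡ a (//-rightDividesʳ z (invWord a)) ⟩
      a ++ invWord a                       ≈⟨ inverseʳ a ⟩
      []                                   ∎

  extend-commutator : ∀ a z u {t} → (∀ w → Commutes z w) → a ++ x₀ ≈ x₀ ++ a ++ z →
                      u ++ x₀ ≈ x₀ ++ u ++ t → (a ++ u) ++ x₀ ≈ x₀ ++ (a ++ u) ++ z ++ t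
  extend-commutator a z u {t} cz eqa equ = begin
    (a ++ u) ++ x₀          ≈⟨ ≡⇒≈ (++-assoc a u x₀) ⟩
    a ++ u ++ x₀            ≈⟨ ++-congˡ a equ ⟩
    a ++ x₀ ++ u ++ t       ≈⟨ ≡⇒≈ (++-assoc a x₀ _) ⟨
    (a ++ x₀) ++ u ++ t     ≈⟨ ++-congʳ (u ++ t) eqa ⟩
    (x₀ ++ a ++ z) ++ u ++ t ≈⟨ ++-congˡ x₀ (≡⇒≈ (++-assoc a z _)) ⟩
    x₀ ++ a ++ z ++ u ++ t  ≈⟨ ++-congˡ (x₀ ++ a) (≡⇒≈ (≡.sym (++-assoc z u t))) ⟩
    x₀ ++ a ++ (z ++ u) ++ t ≈⟨ ++-congˡ (x₀ ++ a) (++-congʳ t (cz u)) ⟩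
    x₀ ++ a ++ (u ++ z) ++ t ≈⟨ ++-congˡ (x₀ ++ a) (≡⇒≈ (++-assoc u z t)) ⟩
    x₀ ++ a ++ u ++ z ++ t  ≈⟨ ++-congˡ x₀ (≡⇒≈ (++-assoc a u _)) ⟨
    x₀ ++ (a ++ u) ++ z ++ t ∎

  ψ-commutator : ∀ u → u ++ x₀ ≈ x₀ ++ u ++ ψ u
  ψ-commutator [] = pe-refl
  ψ-commutator ((x zero , true) ∷ u) =
    extend-commutator x₀ [] u (λ w → commutes-sym {w} (commutes-ε w)) pe-refl (ψ-commutator u)
  ψ-commutator ((x zero , false) ∷ u) =
    extend-commutator (invWord x₀) [] u (λ w → commutes-sym {w} (commutes-ε w))
      (pe-trans (inverseˡ x₀) (pe-sym (inverseʳ x₀))) (ψ-commutator u)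
  ψ-commutator ((x (suc i) , true) ∷ u) =
    extend-commutator (gen (x (suc i))) [ Y i ] u (central-Y i) (x-commutator i) (ψ-commutator u)
  ψ-commutator ((x (suc i) , false) ∷ u) =
    extend-commutator (invWord (gen (x (suc i)))) [ invLetter (Y i) ] u (central-y 0 (suc i) _)
      (inverse-commutator (gen (x (suc i))) [ Y i ] (central-Y i) (x-commutator i)) (ψ-commutator u)
  ψ-commutator ((y i k i<k , true) ∷ u) =
    extend-commutator (gen (y i k i<k)) [] u (λ w → commutes-sym {w} (commutes-ε w))
      (central-y i k i<k x₀) (ψ-commutator u)
  ψ-commutator ((y i k i<k , false) ∷ u) =
    extend-commutator (invWord (gen (y i k i<k))) [] u (λ w → commutes-sym {w} (commutes-ε w))
      (commutes-sym {x₀} (commutes-⁻¹ {h = gen (y i k i<k)}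
        (commutes-sym {gen (y i k i<k)} (central-y i k i<k x₀))))
      (ψ-commutator u)

  ψ-unique : ∀ u t → u ++ x₀ ≈ x₀ ++ u ++ t → t ≈ ψ u
  ψ-unique u t eq = ∙-cancelˡ u _ _ (∙-cancelˡ x₀ _ _ (pe-trans (pe-sym eq) (ψ-commutator u)))

  replicate-ψ : ∀ n i → ψ (replicate n (x (suc i) , true)) ≡ replicate n (Y i)
  replicate-ψ zero    i = refl
  replicate-ψ (suc n) i = cong (Y i ∷_) (replicate-ψ n i)

  -- Exponent p is imposed on the x's only. The trivial element x_{i+1}^p has a trivial commutator
  -- with x₀, and by `ψ-commutator` this commutator is the p-th power of `Y i`.
  Y-torsion : ∀ i → replicate p (Y i) ≈ []
  Y-torsion i = subst (_≈ []) (replicate-ψ p i)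
    (pe-sym (∙-cancelˡ x₀ _ _ (begin
      x₀ ++ []                       ≡⟨⟩
      x₀                             ≈⟨ ++-congʳ x₀ xᵖ≈[] ⟨
      xᵖ ++ x₀                       ≈⟨ ψ-commutator xᵖ ⟩
      x₀ ++ xᵖ ++ ψ xᵖ               ≈⟨ ++-congˡ x₀ (++-congʳ (ψ xᵖ) xᵖ≈[]) ⟩
      x₀ ++ ψ xᵖ ∎)))
    where
    xᵖ = replicate p (x (suc i) , true)
    xᵖ≈[] : xᵖ ≈ []
    xᵖ≈[] = pe-rel (rel-pow (suc i))

  -- Exponents modulo p and the vanishing of ψ.

  δ : ℕ → ℕ → ℕ
  δ zero    zero    = 1
  δ zero    (suc _) = 0
  δ (suc _) zero    = 0
  δ (suc i) (suc j) = δ i j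

  sign : Bool → ℕ
  sign true  = 1
  sign false = p′

  -- The exponent of x_a in u modulo p: an inverse letter counts as p − 1.
  e : ℕ → Word Gen → ℕ
  e a []                  = 0
  e a ((x i , b) ∷ u)     = sign b * δ a i + e a u
  e a ((y _ _ _ , b) ∷ u) = e a u

  e-++ : ∀ a u v → e a (u ++ v) ≡ e a u + e a v
  e-++ a []                  v = refl
  e-++ a ((x i , b) ∷ u)     v =
    ≡.trans (cong (λ r → sign b * δ a i + r) (e-++ a u v)) (≡.sym (+-assoc (sign b * δ a i) _ _))
  e-++ a ((y _ _ _ , b) ∷ u) v = e-++ a u v

  δ-refl : ∀ a → δ a a ≡ 1
  δ-refl zero    = refl
  δ-refl (suc a) = δ-refl a

  δ-≢ : ∀ {a b} → a ≢ b → δ a b ≡ 0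
  δ-≢ {zero}  {zero}  a≢b = contradiction refl a≢b
  δ-≢ {zero}  {suc b} a≢b = refl
  δ-≢ {suc a} {zero}  a≢b = refl
  δ-≢ {suc a} {suc b} a≢b = δ-≢ λ eq → a≢b (cong suc eq)

  remove : ℕ → Word Gen → Word Gen
  remove a [] = []
  remove a ((x i , b) ∷ u) with i ≟ a
  ... | yes _ = remove a u
  ... | no  _ = (x i , b) ∷ remove a u
  remove a (l@(y _ _ _ , _) ∷ u) = l ∷ remove a u

  length-remove : ∀ a u → length (remove a u) ≤ length u
  length-remove a [] = z≤n
  length-remove a ((x i , b) ∷ u) with i ≟ a
  ... | yes _ = m≤n⇒m≤1+n (length-remove a u)
  ... | no  _ = s≤s (length-remove a u)
  length-remove a ((y _ _ _ , _) ∷ u) = s≤s (length-remove a u)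

  e-remove : ∀ a u → e a (remove a u) ≡ 0
  e-remove a [] = refl
  e-remove a ((x i , b) ∷ u) with i ≟ a
  ... | yes _ = e-remove a u
  ... | no i≢a rewrite δ-≢ (λ eq → i≢a (≡.sym eq)) | *-zeroʳ (sign b) = e-remove a u
  e-remove a ((y _ _ _ , _) ∷ u) = e-remove a u

  e-remove-≢ : ∀ a c u → c ≢ a → e c (remove a u) ≡ e c u
  e-remove-≢ a c [] c≢a = refl
  e-remove-≢ a c ((x i , b) ∷ u) c≢a with i ≟ a
  ... | yes refl rewrite δ-≢ c≢a | *-zeroʳ (sign b) = e-remove-≢ a c u c≢a
  ... | no _ = cong (λ r → sign b * δ c i + r) (e-remove-≢ a c u c≢a)
  e-remove-≢ a c ((y _ _ _ , _) ∷ u) c≢a = e-remove-≢ a c u c≢a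

  replicate-torsion : ∀ i n → p ∣ℕ n → replicate n (Y i) ≈ []
  replicate-torsion i .(q * p) (ℕ∣.divides-refl q) = multiples q
    where
    multiples : ∀ q → replicate (q * p) (Y i) ≈ []
    multiples zero    = pe-refl
    multiples (suc q) = pe-trans (≡⇒≈ (≡.sym (replicate-+ p (q * p)))) (pe-cong (Y-torsion i) (multiples q))

  commutes-replicate : ∀ n i u → replicate n (Y i) ++ u ≈ u ++ replicate n (Y i)
  commutes-replicate zero    i u = ≡⇒≈ (≡.sym (++-identityʳ u))
  commutes-replicate (suc n) i u = begin
    [ Y i ] ++ replicate n (Y i) ++ u  ≈⟨ ++-congˡ [ Y i ] (commutes-replicate n i u) ⟩
    [ Y i ] ++ u ++ replicate n (Y i)  ≈⟨ ≡⇒≈ (++-assoc [ Y i ] u _) ⟨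
    ([ Y i ] ++ u) ++ replicate n (Y i) ≈⟨ ++-congʳ (replicate n (Y i)) (central-Y i u) ⟩
    (u ++ [ Y i ]) ++ replicate n (Y i) ≈⟨ ≡⇒≈ (++-assoc u [ Y i ] _) ⟩
    u ++ replicate (suc n) (Y i) ∎

  inverse-power : ∀ i → [ invLetter (Y i) ] ≈ replicate p′ (Y i)
  inverse-power i = ∙-cancelˡ [ Y i ] _ _ (pe-trans (inverseʳ [ Y i ]) (pe-sym (Y-torsion i)))

  -- The values of ψ are central, so the contributions of x_{i+1} can be gathered in front. By
  -- torsion an inverse letter contributes p - 1 copies of `Y i`, which matches `sign false`.
  ψ-remove : ∀ i u → ψ u ≈ replicate (e (suc i) u) (Y i) ++ ψ (remove (suc i) u)
  ψ-remove i [] = pe-refl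
  ψ-remove i ((x zero , b) ∷ u) rewrite *-zeroʳ (sign b) = ψ-remove i u
  ψ-remove i ((x (suc j) , b) ∷ u) with suc j ≟ suc i
  ψ-remove i ((x (suc j) , true) ∷ u) | yes refl rewrite δ-refl i = ++-congˡ [ Y i ] (ψ-remove i u)
  ψ-remove i ((x (suc j) , false) ∷ u) | yes refl rewrite δ-refl i | *-identityʳ p′ = begin
    [ invLetter (Y i) ] ++ ψ u           ≈⟨ pe-cong (inverse-power i) (ψ-remove i u) ⟩
    replicate p′ (Y i) ++ replicate (e (suc i) u) (Y i) ++ ψ (remove (suc i) u)
      ≈⟨ ≡⇒≈ (++-assoc (replicate p′ (Y i)) _ _) ⟨
    (replicate p′ (Y i) ++ replicate (e (suc i) u) (Y i)) ++ ψ (remove (suc i) u)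
      ≈⟨ ++-congʳ _ (≡⇒≈ (replicate-+ p′ (e (suc i) u))) ⟩
    replicate (p′ + e (suc i) u) (Y i) ++ ψ (remove (suc i) u) ∎
  ψ-remove i ((x (suc j) , true) ∷ u) | no j≢i rewrite δ-≢ {suc i} {suc j} (λ eq → j≢i (≡.sym eq)) = begin
    [ Y j ] ++ ψ u ≈⟨ ++-congˡ [ Y j ] (ψ-remove i u) ⟩
    [ Y j ] ++ replicate (e (suc i) u) (Y i) ++ ψ (remove (suc i) u)
      ≈⟨ ++-congʳ (ψ (remove (suc i) u)) (commutes-replicate (e (suc i) u) i [ Y j ]) ⟨
    (replicate (e (suc i) u) (Y i) ++ [ Y j ]) ++ ψ (remove (suc i) u)
      ≈⟨ ≡⇒≈ (++-assoc (replicate (e (suc i) u) (Y i)) _ _) ⟩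
    replicate (e (suc i) u) (Y i) ++ Y j ∷ ψ (remove (suc i) u) ∎
  ψ-remove i ((x (suc j) , false) ∷ u) | no j≢i
    rewrite δ-≢ {suc i} {suc j} (λ eq → j≢i (≡.sym eq)) | *-zeroʳ p′ = begin
    [ z ] ++ ψ u ≈⟨ ++-congˡ [ z ] (ψ-remove i u) ⟩
    [ z ] ++ replicate (e (suc i) u) (Y i) ++ ψ (remove (suc i) u)
      ≈⟨ ++-congʳ (ψ (remove (suc i) u)) (commutes-replicate (e (suc i) u) i [ z ]) ⟨
    (replicate (e (suc i) u) (Y i) ++ [ z ]) ++ ψ (remove (suc i) u)
      ≈⟨ ≡⇒≈ (++-assoc (replicate (e (suc i) u) (Y i)) _ _) ⟩
    replicate (e (suc i) u) (Y i) ++ z ∷ ψ (remove (suc i) u) ∎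
    where z = invLetter (Y j)
  ψ-remove i ((y _ _ _ , b) ∷ u) = ψ-remove i u

  ψ-remove-0 : ∀ u → ψ u ≡ ψ (remove 0 u)
  ψ-remove-0 []                        = refl
  ψ-remove-0 ((x zero , b) ∷ u)        = ψ-remove-0 u
  ψ-remove-0 ((x (suc i) , true) ∷ u)  = cong (_ ∷_) (ψ-remove-0 u)
  ψ-remove-0 ((x (suc i) , false) ∷ u) = cong (_ ∷_) (ψ-remove-0 u)
  ψ-remove-0 ((y _ _ _ , b) ∷ u)       = ψ-remove-0 u

  ψ-remove-torsion : ∀ a u → p ∣ℕ e a u → ψ u ≈ ψ (remove a u)
  ψ-remove-torsion zero    u _  = ≡⇒≈ (ψ-remove-0 u)
  ψ-remove-torsion (suc i) u p∣ =
    pe-trans (ψ-remove i u) (++-congʳ (ψ (remove (suc i) u)) (replicate-torsion i _ p∣))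

  length-remove-head : ∀ a b u → length (remove a ((x a , b) ∷ u)) ≤ length u
  length-remove-head a b u with a ≟ a
  ... | yes _  = length-remove a u
  ... | no a≢a = contradiction refl a≢a

  -- If the exponent of the first x-letter is divisible by p, all occurrences of that generator can
  -- be deleted without changing ψ. The word gets shorter and the other exponents stay the same, so
  -- a pivot found in the remainder is a pivot of the whole word.
  pivot-or-trivial : ∀ u → (∃ λ a → ¬ p ∣ℕ e a u) ⊎ ψ u ≈ []
  pivot-or-trivial u = go u (<-wellFounded (length u))
    where
    go : ∀ u → Acc _<_ (length u) → (∃ λ a → ¬ p ∣ℕ e a u) ⊎ ψ u ≈ []
    go [] _ = inj₂ pe-refl
    go ((y _ _ _ , _) ∷ u) (acc rec) = go u (rec ≤-refl)
    go w@((x a , b) ∷ u) (acc rec) with p ∣ℕ? e a w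
    ... | no p∤  = inj₁ (a , p∤)
    ... | yes p∣ with go (remove a w) (rec (s≤s (length-remove-head a b u)))
    ... | inj₂ triv = inj₂ (pe-trans (ψ-remove-torsion a w p∣) triv)
    ... | inj₁ (c , p∤) with c ≟ a
    ... | yes refl = contradiction (subst (p ∣ℕ_) (≡.sym (e-remove a w)) (p ℕ∣.∣0)) p∤
    ... | no c≢a   = inj₁ (c , λ d → p∤ (subst (p ∣ℕ_) (≡.sym (e-remove-≢ a c w c≢a)) d))

-- Integers modulo p.

module Congruence (p : ℕ) where

  infix 4 _≋_
  record _≋_ (i j : ℤ) : Set where
    constructor congruent
    field difference : + p ∣ᶻ i - j
  open _≋_ public

  ≡⇒≋ : ∀ {i j} → i ≡ j → i ≋ j
  ≡⇒≋ {i} refl = congruent (divides 0ℤ (ℤ.+-inverseʳ i))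

  ≋-refl : ∀ {i} → i ≋ i
  ≋-refl = ≡⇒≋ refl

  ≋-sym : ∀ {i j} → i ≋ j → j ≋ i
  ≋-sym {i} {j} (congruent d) = congruent (subst (+ p ∣ᶻ_) (lemma i j) (∣m⇒∣-m d))
    where lemma : ∀ i j → - (i - j) ≡ j - i
          lemma = solve-∀

  ≋-trans : ∀ {i j k} → i ≋ j → j ≋ k → i ≋ k
  ≋-trans {i} {j} {k} (congruent d) (congruent d′) =
    congruent (subst (+ p ∣ᶻ_) (lemma i j k) (∣m∣n⇒∣m+n d d′))
    where lemma : ∀ i j k → (i - j) +ᶻ (j - k) ≡ i - k
          lemma = solve-∀

  ≋-setoid : Setoid 0ℓ 0ℓ
  ≋-setoid = record { _≈_ = _≋_ ; isEquivalence = record { refl = ≋-refl ; sym = ≋-sym ; trans = ≋-trans } }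

  +-cong : ∀ {i i′ j j′} → i ≋ i′ → j ≋ j′ → i +ᶻ j ≋ i′ +ᶻ j′
  +-cong {i} {i′} {j} {j′} (congruent d) (congruent d′) =
    congruent (subst (+ p ∣ᶻ_) (lemma i i′ j j′) (∣m∣n⇒∣m+n d d′))
    where lemma : ∀ i i′ j j′ → (i - i′) +ᶻ (j - j′) ≡ (i +ᶻ j) - (i′ +ᶻ j′)
          lemma = solve-∀

  *-cong : ∀ {i i′ j j′} → i ≋ i′ → j ≋ j′ → i *ᶻ j ≋ i′ *ᶻ j′
  *-cong {i} {i′} {j} {j′} (congruent d) (congruent d′) =
    congruent (subst (+ p ∣ᶻ_) (lemma i i′ j j′) (∣m∣n⇒∣m+n (∣m⇒∣m*n j d) (∣n⇒∣m*n i′ d′)))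
    where lemma : ∀ i i′ j j′ → (i - i′) *ᶻ j +ᶻ i′ *ᶻ (j - j′) ≡ i *ᶻ j - i′ *ᶻ j′
          lemma = solve-∀

  -‿cong : ∀ {i j} → i ≋ j → - i ≋ - j
  -‿cong {i} {j} d = ≡.subst₂ _≋_ (ℤ.-1*i≡-i i) (ℤ.-1*i≡-i j) (*-cong (≋-refl { - 1ℤ}) d)

  +-cancelˡ : ∀ i {j k} → i +ᶻ j ≋ i +ᶻ k → j ≋ k
  +-cancelˡ i {j} {k} d = ≡.subst₂ _≋_ (lemma i j) (lemma i k) (+-cong (≋-refl { - i}) d)
    where lemma : ∀ i j → - i +ᶻ (i +ᶻ j) ≡ j
          lemma = solve-∀

  +-cancelʳ : ∀ k {i j} → i +ᶻ k ≋ j +ᶻ k → i ≋ j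
  +-cancelʳ k {i} {j} d = +-cancelˡ k (≡.subst₂ _≋_ (ℤ.+-comm i k) (ℤ.+-comm j k) d)

  zero-product : Prime p → ∀ {k i} → k *ᶻ i ≋ 0ℤ → k ≋ 0ℤ ⊎ i ≋ 0ℤ
  zero-product pr {k} {i} (congruent d) = Sum.map ∣⇒≋ ∣⇒≋ (euclidsLemma (abs k) (abs i) pr
    (subst (p ∣ℕ_) (ℤ.abs-* k i) (∣⇒∣ᵤ (subst (+ p ∣ᶻ_) (ℤ.+-identityʳ (k *ᶻ i)) d))))
    where
    ∣⇒≋ : ∀ {j} → p ∣ℕ abs j → j ≋ 0ℤ
    ∣⇒≋ {j} p∣j = congruent (subst (+ p ∣ᶻ_) (≡.sym (ℤ.+-identityʳ j)) (∣ᵤ⇒∣ p∣j))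

  *-cancelˡ : Prime p → ∀ {k i j} → ¬ k ≋ 0ℤ → k *ᶻ i ≋ k *ᶻ j → i ≋ j
  *-cancelˡ pr {k} {i} {j} k≠0 d = Sum.[ (λ k≋0 → contradiction k≋0 k≠0) , difference≋0 ]
    (zero-product pr {k} {i - j} (≡.subst₂ _≋_ (lemma k i j) (ℤ.+-inverseʳ (k *ᶻ j))
      (+-cong d (≋-refl { - (k *ᶻ j)}))))
    where
    lemma : ∀ k i j → k *ᶻ i - k *ᶻ j ≡ k *ᶻ (i - j)
    lemma = solve-∀
    difference≋0 : i - j ≋ 0ℤ → i ≋ j
    difference≋0 (congruent d) = congruent (subst (+ p ∣ᶻ_) (ℤ.+-identityʳ (i - j)) d)

  ∣⇒≋0 : ∀ {n} → p ∣ℕ n → + n ≋ 0ℤ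
  ∣⇒≋0 {n} d = congruent (subst (+ p ∣ᶻ_) (≡.sym (ℤ.+-identityʳ (+ n))) (∣ᵤ⇒∣ d))

  ≋0⇒∣ : ∀ {n} → + n ≋ 0ℤ → p ∣ℕ n
  ≋0⇒∣ {n} (congruent d) = ∣⇒∣ᵤ (subst (+ p ∣ᶻ_) (ℤ.+-identityʳ (+ n)) d)

-- Heisenberg coordinates on L_p.

module Invariants (p′ : ℕ) where
  open Lp p′
  open Congruence p public

  ε : ℕ → Gen → ℤ
  ε a (x i)     = + δ a i
  ε a (y _ _ _) = 0ℤ

  -- The integer version of `e`. Natural numbers were needed there to count letters; here minors
  -- require subtraction.
  E : ℕ → Word Gen → ℤ
  E a []            = 0ℤ
  E a ((g , b) ∷ u) = + sign b *ᶻ ε a g +ᶻ E a u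

  E-e : ∀ a u → E a u ≡ + e a u
  E-e a []                  = refl
  E-e a ((x i , b) ∷ u)     = cong₂ _+ᶻ_ (≡.sym (ℤ.pos-* (sign b) (δ a i))) (E-e a u)
  E-e a ((y _ _ _ , b) ∷ u) =
    ≡.trans (cong (_+ᶻ E a u) (ℤ.*-zeroʳ (+ sign b))) (≡.trans (ℤ.+-identityˡ _) (E-e a u))

  E-++ : ∀ a u v → E a (u ++ v) ≡ E a u +ᶻ E a v
  E-++ a []            v = ≡.sym (ℤ.+-identityˡ (E a v))
  E-++ a ((g , b) ∷ u) v =
    ≡.trans (cong (+ sign b *ᶻ ε a g +ᶻ_) (E-++ a u v)) (≡.sym (ℤ.+-assoc (+ sign b *ᶻ ε a g) _ _))

  minor : ℕ → ℕ → Word Gen → Word Gen → ℤ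
  minor a b u v = E a u *ᶻ E b v - E b u *ᶻ E a v

  -- The value on y_{i,k} is forced by y_{i,k} = [x_i,x_k]: in the antisymmetric form the central
  -- coordinate of a commutator is twice the minor of the two exponent vectors.
  β : ℕ → ℕ → Gen → ℤ
  β a b (x _)     = 0ℤ
  β a b (y i k _) = + 2 *ᶻ (+ δ a i *ᶻ + δ b k - + δ b i *ᶻ + δ a k)

  -- u ↦ (E a u , E b u , ω a b u) is a homomorphism to the Heisenberg group over ℤ/p in its
  -- antisymmetric form (r,s,t)(r′,s′,t′) = (r+r′, s+s′, t+t′+rs′−sr′).
  ω : ℕ → ℕ → Word Gen → ℤ
  ω a b []            = 0ℤ
  ω a b ((g , s) ∷ u) = + sign s *ᶻ β a b g +ᶻ minor a b [ (g , s) ] u +ᶻ ω a b u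

  ω-++ : ∀ a b u v → ω a b (u ++ v) ≡ ω a b u +ᶻ ω a b v +ᶻ minor a b u v
  ω-++ a b [] v = lemma (ω a b v) (E a v) (E b v)
    where lemma : ∀ w r s → w ≡ 0ℤ +ᶻ w +ᶻ (0ℤ *ᶻ s - 0ℤ *ᶻ r)
          lemma = solve-∀
  ω-++ a b (l@(g , s) ∷ u) v
    rewrite ω-++ a b u v | E-++ a u v | E-++ b u v
          | E-++ a [ l ] u | E-++ b [ l ] u =
    lemma (+ sign s *ᶻ β a b g) (E a [ l ]) (E b [ l ]) (E a u) (E b u) (E a v) (E b v) (ω a b u) (ω a b v)
    where
    lemma : ∀ t r s r₁ s₁ r₂ s₂ w₁ w₂ →
            t +ᶻ (r *ᶻ (s₁ +ᶻ s₂) - s *ᶻ (r₁ +ᶻ r₂)) +ᶻ (w₁ +ᶻ w₂ +ᶻ (r₁ *ᶻ s₂ - s₁ *ᶻ r₂)) ≡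
            (t +ᶻ (r *ᶻ s₁ - s *ᶻ r₁) +ᶻ w₁) +ᶻ w₂ +ᶻ ((r +ᶻ r₁) *ᶻ s₂ - (s +ᶻ s₁) *ᶻ r₂)
    lemma = solve-∀

  E-power : ∀ a i n → E a (replicate n (x i , true)) ≡ + n *ᶻ + δ a i
  E-power a i zero    = refl
  E-power a i (suc n) rewrite E-power a i n = lemma (+ δ a i) (+ n)
    where lemma : ∀ d n → 1ℤ *ᶻ d +ᶻ n *ᶻ d ≡ (1ℤ +ᶻ n) *ᶻ d
          lemma = solve-∀

  -- Powers of one generator have proportional exponent vectors, so every minor vanishes. Thanks to
  -- the antisymmetric form no binomial coefficient appears in a p-th power.
  ω-power : ∀ a b i n → ω a b (replicate n (x i , true)) ≡ 0ℤ
  ω-power a b i zero    = refl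
  ω-power a b i (suc n) rewrite ω-power a b i n | E-power a i n | E-power b i n =
    lemma (+ δ a i) (+ δ b i) (+ n)
    where lemma : ∀ r s n → 1ℤ *ᶻ 0ℤ +ᶻ ((1ℤ *ᶻ r +ᶻ 0ℤ) *ᶻ (n *ᶻ s) - (1ℤ *ᶻ s +ᶻ 0ℤ) *ᶻ (n *ᶻ r)) +ᶻ 0ℤ ≡ 0ℤ
          lemma = solve-∀

  -- The modulus is written as 1 + p′ to suit the ring solver.
  multiple : ∀ {i} q → i - 0ℤ ≡ q *ᶻ (1ℤ +ᶻ + p′) → i ≋ 0ℤ
  multiple q eq = congruent (divides q eq)

  E-rel : ∀ a {r} → LpRel p r → E a r ≋ 0ℤ
  E-rel a (rel-pow i) = multiple (+ δ a i) (≡.trans (cong (_- 0ℤ) (E-power a i p)) (lemma (+ δ a i) (+ p′)))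
    where lemma : ∀ d q → (1ℤ +ᶻ q) *ᶻ d - 0ℤ ≡ d *ᶻ (1ℤ +ᶻ q)
          lemma = solve-∀
  E-rel a (rel-defy i k i<k) = multiple (+ δ a i +ᶻ + δ a k) (lemma (+ δ a i) (+ δ a k) (+ p′))
    where lemma : ∀ c d q → (q *ᶻ c +ᶻ (q *ᶻ d +ᶻ (1ℤ *ᶻ c +ᶻ (1ℤ *ᶻ d +ᶻ (q *ᶻ 0ℤ +ᶻ 0ℤ))))) - 0ℤ ≡
                            (c +ᶻ d) *ᶻ (1ℤ +ᶻ q)
          lemma = solve-∀
  E-rel a (rel-cent i k _ r) = multiple (+ δ a r) (lemma (+ δ a r) (+ p′))
    where lemma : ∀ d q → (q *ᶻ 0ℤ +ᶻ (q *ᶻ d +ᶻ (1ℤ *ᶻ 0ℤ +ᶻ (1ℤ *ᶻ d +ᶻ 0ℤ)))) - 0ℤ ≡ d *ᶻ (1ℤ +ᶻ q)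
          lemma = solve-∀

  E-cancel : ∀ a l → E a (l ∷ invLetter l ∷ []) ≋ 0ℤ
  E-cancel a (g , true)  = multiple (ε a g) (lemma (ε a g) (+ p′))
    where lemma : ∀ d q → (1ℤ *ᶻ d +ᶻ (q *ᶻ d +ᶻ 0ℤ)) - 0ℤ ≡ d *ᶻ (1ℤ +ᶻ q)
          lemma = solve-∀
  E-cancel a (g , false) = multiple (ε a g) (lemma (ε a g) (+ p′))
    where lemma : ∀ d q → (q *ᶻ d +ᶻ (1ℤ *ᶻ d +ᶻ 0ℤ)) - 0ℤ ≡ d *ᶻ (1ℤ +ᶻ q)
          lemma = solve-∀

  ω-cancel : ∀ a b l → ω a b (l ∷ invLetter l ∷ []) ≋ 0ℤ
  ω-cancel a b (g , true)  = multiple (β a b g) (lemma (ε a g) (ε b g) (β a b g) (+ p′))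
    where
    lemma : ∀ r s t q →
      (1ℤ *ᶻ t +ᶻ ((1ℤ *ᶻ r +ᶻ 0ℤ) *ᶻ (q *ᶻ s +ᶻ 0ℤ) - (1ℤ *ᶻ s +ᶻ 0ℤ) *ᶻ (q *ᶻ r +ᶻ 0ℤ)) +ᶻ
      (q *ᶻ t +ᶻ ((q *ᶻ r +ᶻ 0ℤ) *ᶻ 0ℤ - (q *ᶻ s +ᶻ 0ℤ) *ᶻ 0ℤ) +ᶻ 0ℤ)) - 0ℤ ≡ t *ᶻ (1ℤ +ᶻ q)
    lemma = solve-∀
  ω-cancel a b (g , false) = multiple (β a b g) (lemma (ε a g) (ε b g) (β a b g) (+ p′))
    where
    lemma : ∀ r s t q →
      (q *ᶻ t +ᶻ ((q *ᶻ r +ᶻ 0ℤ) *ᶻ (1ℤ *ᶻ s +ᶻ 0ℤ) - (q *ᶻ s +ᶻ 0ℤ) *ᶻ (1ℤ *ᶻ r +ᶻ 0ℤ)) +ᶻ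
      (1ℤ *ᶻ t +ᶻ ((1ℤ *ᶻ r +ᶻ 0ℤ) *ᶻ 0ℤ - (1ℤ *ᶻ s +ᶻ 0ℤ) *ᶻ 0ℤ) +ᶻ 0ℤ)) - 0ℤ ≡ t *ᶻ (1ℤ +ᶻ q)
    lemma = solve-∀

  ω-++-central : ∀ a b u v → E a v ≋ 0ℤ → E b v ≋ 0ℤ → ω a b (u ++ v) ≋ ω a b u +ᶻ ω a b v
  ω-++-central a b u v a0 b0 = begin
    ω a b (u ++ v) ≡⟨ ω-++ a b u v ⟩
    ω a b u +ᶻ ω a b v +ᶻ minor a b u v
      ≈⟨ +-cong (≋-refl {ω a b u +ᶻ ω a b v})
           (+-cong (*-cong (≋-refl {E a u}) b0) (-‿cong (*-cong (≋-refl {E b u}) a0))) ⟩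
    ω a b u +ᶻ ω a b v +ᶻ (E a u *ᶻ 0ℤ - E b u *ᶻ 0ℤ) ≡⟨ lemma (ω a b u +ᶻ ω a b v) (E a u) (E b u) ⟩
    ω a b u +ᶻ ω a b v ∎
    where
    open SetoidReasoning ≋-setoid
    lemma : ∀ w r s → w +ᶻ (r *ᶻ 0ℤ - s *ᶻ 0ℤ) ≡ w
    lemma = solve-∀

  -- The relators are a parameter to avoid a circle: the commutator formula proved here is itself
  -- used, over the free group, to check the relators of L_p.
  module Respects {R : Word Gen → Set} (E-rel : ∀ a {r} → R r → E a r ≋ 0ℤ)
                  (ω-rel : ∀ a b {r} → R r → ω a b r ≋ 0ℤ) where

    private _∼_ = PresEq R

    E-cong : ∀ a {u v} → u ∼ v → E a u ≋ E a v
    E-cong a pe-refl         = ≋-refl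
    E-cong a (pe-sym d)      = ≋-sym (E-cong a d)
    E-cong a (pe-trans d d′) = ≋-trans (E-cong a d) (E-cong a d′)
    E-cong a (pe-cong {u} {u′} {v} {v′} d d′) rewrite E-++ a u v | E-++ a u′ v′ =
      +-cong (E-cong a d) (E-cong a d′)
    E-cong a (pe-cancel l)   = E-cancel a l
    E-cong a (pe-rel r)      = E-rel a r

    minor-cong : ∀ a b {u u′ v v′} → u ∼ u′ → v ∼ v′ → minor a b u v ≋ minor a b u′ v′
    minor-cong a b d d′ =
      +-cong (*-cong (E-cong a d) (E-cong b d′)) (-‿cong (*-cong (E-cong b d) (E-cong a d′)))

    ω-cong : ∀ a b {u v} → u ∼ v → ω a b u ≋ ω a b v
    ω-cong a b pe-refl         = ≋-refl
    ω-cong a b (pe-sym d)      = ≋-sym (ω-cong a b d)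
    ω-cong a b (pe-trans d d′) = ≋-trans (ω-cong a b d) (ω-cong a b d′)
    ω-cong a b (pe-cong {u} {u′} {v} {v′} d d′) rewrite ω-++ a b u v | ω-++ a b u′ v′ =
      +-cong (+-cong (ω-cong a b d) (ω-cong a b d′)) (minor-cong a b d d′)
    ω-cong a b (pe-cancel l)   = ω-cancel a b l
    ω-cong a b (pe-rel r)      = ω-rel a b r

    E-comm : ∀ a g h → E a (comm g h) ≋ 0ℤ
    E-comm a g h = +-cancelˡ (E a g +ᶻ E a h) (begin
      (E a g +ᶻ E a h) +ᶻ E a (comm g h) ≡⟨ cong (_+ᶻ E a (comm g h)) (ℤ.+-comm (E a g) (E a h)) ⟩
      (E a h +ᶻ E a g) +ᶻ E a (comm g h) ≡⟨ cong (_+ᶻ E a (comm g h)) (≡.sym (E-++ a h g)) ⟩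
      E a (h ++ g) +ᶻ E a (comm g h)     ≡⟨ ≡.sym (E-++ a (h ++ g) (comm g h)) ⟩
      E a ((h ++ g) ++ comm g h)         ≈⟨ E-cong a (Commuting.commutator (PresentedGroup.group R) g h) ⟨
      E a (g ++ h)                       ≡⟨ E-++ a g h ⟩
      E a g +ᶻ E a h                     ≡⟨ ≡.sym (ℤ.+-identityʳ _) ⟩
      (E a g +ᶻ E a h) +ᶻ 0ℤ ∎)
      where open SetoidReasoning ≋-setoid

    -- Compare g h with h g [g,h]. The commutator has zero exponents, so ω is additive at that
    -- junction, and exchanging g and h reverses the sign of the minor; hence the factor 2.
    ω-comm : ∀ a b g h → ω a b (comm g h) ≋ + 2 *ᶻ minor a b g h
    ω-comm a b g h = +-cancelˡ (ω a b (h ++ g)) (begin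
      ω a b (h ++ g) +ᶻ ω a b (comm g h) ≈⟨ ω-++-central a b (h ++ g) (comm g h) (E-comm a g h) (E-comm b g h) ⟨
      ω a b ((h ++ g) ++ comm g h)       ≈⟨ ω-cong a b (Commuting.commutator (PresentedGroup.group R) g h) ⟨
      ω a b (g ++ h)                     ≡⟨ ω-++ a b g h ⟩
      ω a b g +ᶻ ω a b h +ᶻ minor a b g h
        ≡⟨ lemma (ω a b g) (ω a b h) (E a g) (E b g) (E a h) (E b h) ⟩
      (ω a b h +ᶻ ω a b g +ᶻ minor a b h g) +ᶻ + 2 *ᶻ minor a b g h
        ≡⟨ cong (_+ᶻ + 2 *ᶻ minor a b g h) (≡.sym (ω-++ a b h g)) ⟩
      ω a b (h ++ g) +ᶻ + 2 *ᶻ minor a b g h ∎)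
      where
      open SetoidReasoning ≋-setoid
      lemma : ∀ w w′ r s r′ s′ → w +ᶻ w′ +ᶻ (r *ᶻ s′ - s *ᶻ r′) ≡
              (w′ +ᶻ w +ᶻ (r′ *ᶻ s - s′ *ᶻ r)) +ᶻ + 2 *ᶻ (r *ᶻ s′ - s *ᶻ r′)
      lemma = solve-∀

  -- The commutator formula in the free group evaluates ω on the relators of L_p.
  module Free = Respects {λ _ → ⊥} (λ _ ()) (λ _ _ ())

  ω-defining : ∀ a b g h k → β a b k ≡ + 2 *ᶻ (ε a g *ᶻ ε b h - ε b g *ᶻ ε a h) →
               (∀ c → ε c k ≡ 0ℤ) → ω a b (comm (gen g) (gen h) ++ invWord (gen k)) ≋ 0ℤ
  ω-defining a b g h k βk εk = begin
    ω a b (comm u v ++ w)           ≈⟨ ω-++-central a b (comm u v) w (E-w a) (E-w b) ⟩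
    ω a b (comm u v) +ᶻ ω a b w     ≈⟨ +-cong (Free.ω-comm a b u v) (≋-refl {ω a b w}) ⟩
    + 2 *ᶻ minor a b u v +ᶻ ω a b w
      ≡⟨ lemma (ε a g) (ε b g) (ε a h) (ε b h) (ε a k) (ε b k) (β a b k) (+ p′) ⟩
    + 2 *ᶻ (ε a g *ᶻ ε b h - ε b g *ᶻ ε a h) +ᶻ + p′ *ᶻ β a b k
      ≡⟨ cong (_+ᶻ + p′ *ᶻ β a b k) (≡.sym βk) ⟩
    β a b k +ᶻ + p′ *ᶻ β a b k      ≈⟨ multiple (β a b k) (lemma′ (β a b k) (+ p′)) ⟩
    0ℤ ∎
    where
    open SetoidReasoning ≋-setoid
    u = gen g
    v = gen h
    w = invWord (gen k)
    E-w : ∀ c → E c w ≋ 0ℤ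
    E-w c = ≡⇒≋ (≡.trans (ℤ.+-identityʳ (+ p′ *ᶻ ε c k))
                (≡.trans (cong (+ p′ *ᶻ_) (εk c)) (ℤ.*-zeroʳ (+ p′))))
    lemma : ∀ r s r′ s′ r″ s″ t q →
      + 2 *ᶻ ((1ℤ *ᶻ r +ᶻ 0ℤ) *ᶻ (1ℤ *ᶻ s′ +ᶻ 0ℤ) - (1ℤ *ᶻ s +ᶻ 0ℤ) *ᶻ (1ℤ *ᶻ r′ +ᶻ 0ℤ)) +ᶻ
      (q *ᶻ t +ᶻ ((q *ᶻ r″ +ᶻ 0ℤ) *ᶻ 0ℤ - (q *ᶻ s″ +ᶻ 0ℤ) *ᶻ 0ℤ) +ᶻ 0ℤ) ≡
      + 2 *ᶻ (r *ᶻ s′ - s *ᶻ r′) +ᶻ q *ᶻ t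
    lemma = solve-∀
    lemma′ : ∀ t q → (t +ᶻ q *ᶻ t) - 0ℤ ≡ t *ᶻ (1ℤ +ᶻ q)
    lemma′ = solve-∀

  ω-centrality : ∀ a b g h → (∀ c → ε c g ≡ 0ℤ) → ω a b (comm (gen g) (gen h)) ≋ 0ℤ
  ω-centrality a b g h εg = ≋-trans (Free.ω-comm a b (gen g) (gen h)) (≡⇒≋ (begin
    + 2 *ᶻ minor a b (gen g) (gen h)   ≡⟨ lemma (ε a g) (ε b g) (E a (gen h)) (E b (gen h)) ⟩
    + 2 *ᶻ (ε a g *ᶻ E b (gen h) - ε b g *ᶻ E a (gen h))
      ≡⟨ cong₂ (λ r s → + 2 *ᶻ (r *ᶻ E b (gen h) - s *ᶻ E a (gen h))) (εg a) (εg b) ⟩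
    + 2 *ᶻ (0ℤ *ᶻ E b (gen h) - 0ℤ *ᶻ E a (gen h)) ≡⟨⟩
    0ℤ ∎))
    where
    open ≡.≡-Reasoning
    lemma : ∀ r s r′ s′ → + 2 *ᶻ ((1ℤ *ᶻ r +ᶻ 0ℤ) *ᶻ s′ - (1ℤ *ᶻ s +ᶻ 0ℤ) *ᶻ r′) ≡ + 2 *ᶻ (r *ᶻ s′ - s *ᶻ r′)
    lemma = solve-∀

  ω-rel : ∀ a b {r} → LpRel p r → ω a b r ≋ 0ℤ
  ω-rel a b (rel-pow i)          = ≡⇒≋ (ω-power a b i p)
  ω-rel a b (rel-defy i k i<k)   = ω-defining a b (x i) (x k) (y i k i<k) refl (λ _ → refl)
  ω-rel a b (rel-cent i k i<k j) = ω-centrality a b (y i k i<k) (x j) (λ _ → refl)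

  open Respects E-rel ω-rel public

-- Multipliers that clear an exponent modulo p.

prime-coprime : ∀ {p m} → Prime p → ¬ p ∣ℕ m → Coprime m p
prime-coprime pr p∤m (d∣m , d∣p) with prime⇒irreducible pr d∣p
... | inj₁ d≡1  = d≡1
... | inj₂ refl = contradiction d∣m p∤m

module _ (p′ : ℕ) where
  private p = suc p′

  clearing-multiplier : ∀ {m} → Coprime m p → ∀ v → ∃ λ n → p ∣ℕ v + n * m
  clearing-multiplier {m} cop v with coprime-Bézout cop
  -- Here i m ≡ 1 modulo p, so -v i is wanted; `p′` stands for -1. In the other case i m ≡ -1 and v
  -- i works directly.
  ... | Bézout.+- i j eq = v * i * p′ , ℕ∣.divides (v * (1 + j * p′)) (begin
    v + v * i * p′ * m          ≡⟨ lemma v i p′ m ⟩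
    v + v * p′ * (i * m)        ≡⟨ cong (λ z → v + v * p′ * z) (≡.sym eq) ⟩
    v + v * p′ * (1 + j * p)    ≡⟨ lemma′ v p′ j ⟩
    v * (1 + j * p′) * p        ∎)
    where
    open ≡.≡-Reasoning
    lemma : ∀ v i q m → v + v * i * q * m ≡ v + v * q * (i * m)
    lemma = ℕRing.solve-∀
    lemma′ : ∀ v q j → v + v * q * (1 + j * (1 + q)) ≡ v * (1 + j * q) * (1 + q)
    lemma′ = ℕRing.solve-∀
  ... | Bézout.-+ i j eq = v * i , ℕ∣.divides (v * j) (begin
    v + v * i * m   ≡⟨ lemma v i m ⟩
    v * (1 + i * m) ≡⟨ cong (v *_) eq ⟩
    v * (j * p)     ≡⟨ ≡.sym (*-assoc v j p) ⟩
    v * j * p       ∎)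
    where
    open ≡.≡-Reasoning
    lemma : ∀ v i m → v + v * i * m ≡ v * (1 + i * m)
    lemma = ℕRing.solve-∀

  -- The bound limits the number of factors spent on each pivot, and through it the length of the
  -- cleared element.
  bounded-clearing-multiplier : ∀ {m} → Coprime m p → ∀ v → ∃ λ n → n ≤ p × p ∣ℕ v + n * m
  bounded-clearing-multiplier {m} cop v with clearing-multiplier cop v
  ... | n , p∣ = n % p , <⇒≤ (m%n<n n p) ,
    ℕ∣.∣m+n∣m⇒∣n (subst (p ∣ℕ_) eq p∣) (ℕ∣.n∣m*n (n / p * m))
    where
    open ≡.≡-Reasoning
    lemma : ∀ v r q m p → v + (r + q * p) * m ≡ q * m * p + (v + r * m)
    lemma = ℕRing.solve-∀
    eq : v + n * m ≡ n / p * m * p + (v + n % p * m)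
    eq = ≡.trans (cong (λ z → v + z * m) (m≡m%n+[m/n]*n n p)) (lemma v (n % p) (n / p) m p)

-- Triangular families and products of their commutators.

module Triangular (p′ : ℕ) (pr : Prime (suc p′)) (odd : suc p′ ≢ 2) where
  open Lp p′
  open Invariants p′

  1≢0 : ¬ 1ℤ ≋ 0ℤ
  1≢0 d = <⇒≢ (nonTrivial⇒n>1 p {{prime⇒nonTrivial pr}}) (≡.sym (ℕ∣.∣1⇒≡1 (≋0⇒∣ d)))

  -- Oddness of p enters through this fact alone. It allows the factor 2 in `ω-comm` to be
  -- cancelled.
  2≢0 : ¬ + 2 ≋ 0ℤ
  2≢0 d = odd (≤-antisym (ℕ∣.∣⇒≤ (≋0⇒∣ d)) (nonTrivial⇒n>1 p {{prime⇒nonTrivial pr}}))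

  Pivoted : Set
  Pivoted = Word Gen × ℕ

  -- Each element vanishes at the pivots of the elements listed after it.
  data Tri : List Pivoted → Set where
    []   : Tri []
    cons : ∀ {g c gs} → ¬ E c g ≋ 0ℤ → (∀ {q} → q ∈ gs → E (proj₂ q) g ≋ 0ℤ) →
           Tri gs → Tri ((g , c) ∷ gs)

  E-replicate : ∀ a n g us → E a (concat (replicate n g ++ us)) ≡ + n *ᶻ E a g +ᶻ E a (concat us)
  E-replicate a zero    g us = ≡.sym (ℤ.+-identityˡ (E a (concat us)))
  E-replicate a (suc n) g us = begin
    E a (g ++ concat (replicate n g ++ us))       ≡⟨ E-++ a g _ ⟩
    E a g +ᶻ E a (concat (replicate n g ++ us))   ≡⟨ cong (E a g +ᶻ_) (E-replicate a n g us) ⟩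
    E a g +ᶻ (+ n *ᶻ E a g +ᶻ E a (concat us))    ≡⟨ lemma (E a g) (+ n) (E a (concat us)) ⟩
    (1ℤ +ᶻ + n) *ᶻ E a g +ᶻ E a (concat us) ∎
    where
    open ≡.≡-Reasoning
    lemma : ∀ r n t → r +ᶻ (n *ᶻ r +ᶻ t) ≡ (1ℤ +ᶻ n) *ᶻ r +ᶻ t
    lemma = solve-∀

  E≋0⇒∣ : ∀ a u → E a u ≋ 0ℤ → p ∣ℕ e a u
  E≋0⇒∣ a u d = ≋0⇒∣ (subst (_≋ 0ℤ) (E-e a u) d)

  ∣⇒E≋0 : ∀ a u → p ∣ℕ e a u → E a u ≋ 0ℤ
  ∣⇒E≋0 a u d = subst (_≋ 0ℤ) (≡.sym (E-e a u)) (∣⇒≋0 d)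

  pivot-multiplier : ∀ c g → ¬ E c g ≋ 0ℤ → ∀ w → ∃ λ n → n ≤ p × E c w +ᶻ + n *ᶻ E c g ≋ 0ℤ
  pivot-multiplier c g g≢0 w =
    map₂ (λ {n} → map₂ (λ p∣ → subst (_≋ 0ℤ) (≡.sym (eq n)) (∣⇒≋0 p∣)))
      (bounded-clearing-multiplier p′ {e c g} (prime-coprime pr (g≢0 ∘ ∣⇒E≋0 c g)) (e c w))
    where
    eq : ∀ n → E c w +ᶻ + n *ᶻ E c g ≡ + (e c w + n * e c g)
    eq n = cong₂ _+ᶻ_ (E-e c w) (≡.trans (cong (+ n *ᶻ_) (E-e c g)) (≡.sym (ℤ.pos-* n (e c g))))

  E-append : ∀ a v n g us →
             E a (v ++ concat (replicate n g ++ us)) ≡ E a (v ++ concat us) +ᶻ + n *ᶻ E a g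
  E-append a v n g us = begin
    E a (v ++ concat (replicate n g ++ us))      ≡⟨ E-++ a v _ ⟩
    E a v +ᶻ E a (concat (replicate n g ++ us))  ≡⟨ cong (E a v +ᶻ_) (E-replicate a n g us) ⟩
    E a v +ᶻ (+ n *ᶻ E a g +ᶻ E a (concat us))   ≡⟨ lemma (E a v) (+ n *ᶻ E a g) (E a (concat us)) ⟩
    (E a v +ᶻ E a (concat us)) +ᶻ + n *ᶻ E a g   ≡⟨ cong (_+ᶻ + n *ᶻ E a g) (≡.sym (E-++ a v (concat us))) ⟩
    E a (v ++ concat us) +ᶻ + n *ᶻ E a g ∎
    where
    open ≡.≡-Reasoning
    lemma : ∀ r s t → r +ᶻ (s +ᶻ t) ≡ (r +ᶻ t) +ᶻ s
    lemma = solve-∀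

  E-append-kernel : ∀ a v n g us → E a g ≋ 0ℤ →
                    E a (v ++ concat (replicate n g ++ us)) ≋ E a (v ++ concat us)
  E-append-kernel a v n g us g≋0 = begin
    E a (v ++ concat (replicate n g ++ us)) ≡⟨ E-append a v n g us ⟩
    E a (v ++ concat us) +ᶻ + n *ᶻ E a g
      ≈⟨ +-cong (≋-refl {E a (v ++ concat us)}) (*-cong (≋-refl {+ n}) g≋0) ⟩
    E a (v ++ concat us) +ᶻ + n *ᶻ 0ℤ ≡⟨ cong (E a (v ++ concat us) +ᶻ_) (ℤ.*-zeroʳ (+ n)) ⟩
    E a (v ++ concat us) +ᶻ 0ℤ        ≡⟨ ℤ.+-identityʳ _ ⟩
    E a (v ++ concat us) ∎
    where open SetoidReasoning ≋-setoid

  -- The factors stay a list because `∣∣-∏` bounds a product by the number of its factors; `P` will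
  -- be a length bound on each of them.
  record Clearing (P : Word Gen → Set) (gs : List Pivoted) (v : Word Gen) : Set where
    field
      factors : List (Word Gen)
      all     : All P factors
      bound   : length factors ≤ length gs * p
      cleared : ∀ {q} → q ∈ gs → E (proj₂ q) (v ++ concat factors) ≋ 0ℤ

  -- The pivots of the tail are cleared first. The head vanishes at them, so the powers of it that
  -- clear its own pivot do not spoil the others.
  clear-pivots : ∀ {P gs} → Tri gs → (∀ {q} → q ∈ gs → P (proj₁ q)) → ∀ v → Clearing P gs v
  clear-pivots [] _ v = record { factors = [] ; all = [] ; bound = z≤n ; cleared = λ () }
  clear-pivots {P} {(g , c) ∷ gs} (cons g≢0 g≋0 tri) Pgs v = extend (pivot-multiplier c g g≢0 (v ++ concat us))
    where
    open Clearing (clear-pivots {P} tri (Pgs ∘ there) v) renaming (factors to us)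
    extend : (∃ λ n → n ≤ p × E c (v ++ concat us) +ᶻ + n *ᶻ E c g ≋ 0ℤ) → Clearing P ((g , c) ∷ gs) v
    extend (n , n≤p , d) = record
      { factors = replicate n g ++ us
      ; all     = All.++⁺ (All.replicate⁺ n (Pgs (here refl))) all
      ; bound   = ≤-trans (≤-reflexive (≡.trans (length-++ (replicate n g))
                                                 (cong (_+ length us) (length-replicate n))))
                          (+-mono-≤ n≤p bound)
      ; cleared = λ { (here refl) → subst (_≋ 0ℤ) (≡.sym (E-append c v n g us)) d
                    ; {_ , a} (there q∈) → ≋-trans (E-append-kernel a v n g us (g≋0 q∈)) (cleared q∈) }
      }

  selection : (gs : List Pivoted) → Fin (2 ^ length gs) → List (Word Gen)
  selection []             _ = []
  selection ((g , c) ∷ gs) i =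
    replicate (toℕ (quotient {2} (2 ^ length gs) i)) g ++ selection gs (remainder {2} (2 ^ length gs) i)

  combine-≡ : ∀ {m} n {i j : Fin (m * n)} → quotient {m} n i ≡ quotient {m} n j →
              remainder {m} n i ≡ remainder {m} n j → i ≡ j
  combine-≡ {m} n {i} {j} eq eq′ =
    ≡.trans (≡.sym (combine-remQuot {m} n i)) (≡.trans (cong₂ combine eq eq′) (combine-remQuot {m} n j))

  bit-injective : (b b′ : Fin 2) → + toℕ b ≋ + toℕ b′ → b ≡ b′
  bit-injective fzero        fzero        _ = refl
  bit-injective fzero        (fsuc fzero) d = contradiction (≋-sym d) 1≢0
  bit-injective (fsuc fzero) fzero        d = contradiction d 1≢0
  bit-injective (fsuc fzero) (fsuc fzero) _ = refl

  -- At the pivots of the tail the head is invisible, so induction recovers the remaining digits;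
  -- the pivot of the head then reveals its own digit.
  selection-injective : ∀ {gs} → Tri gs → (i j : Fin (2 ^ length gs)) →
    (∀ {q} → q ∈ gs → E (proj₂ q) (concat (selection gs i)) ≋ E (proj₂ q) (concat (selection gs j))) → i ≡ j
  selection-injective [] fzero fzero _ = refl
  selection-injective {(g , c) ∷ gs} (cons g≢0 g≋0 tri) i j eq = combine-≡ {2} n same-bit same-rest
    where
    n = 2 ^ length gs
    bit : Fin (2 * n) → ℕ
    bit i = toℕ (quotient {2} n i)
    rest : Fin (2 * n) → Word Gen
    rest i = concat (selection gs (remainder {2} n i))
    split : ∀ a i → E a (concat (selection ((g , c) ∷ gs) i)) ≡ + bit i *ᶻ E a g +ᶻ E a (rest i)
    split a i = E-replicate a (bit i) g (selection gs (remainder {2} n i))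
    drop-head : ∀ {q} → q ∈ gs → ∀ i →
                E (proj₂ q) (concat (selection ((g , c) ∷ gs) i)) ≋ E (proj₂ q) (rest i)
    drop-head {q} q∈ i = begin
      E (proj₂ q) (concat (selection ((g , c) ∷ gs) i)) ≡⟨ split (proj₂ q) i ⟩
      + bit i *ᶻ E (proj₂ q) g +ᶻ E (proj₂ q) (rest i)
        ≈⟨ +-cong (*-cong (≋-refl {+ bit i}) (g≋0 q∈)) (≋-refl {E (proj₂ q) (rest i)}) ⟩
      + bit i *ᶻ 0ℤ +ᶻ E (proj₂ q) (rest i) ≡⟨ cong (_+ᶻ E (proj₂ q) (rest i)) (ℤ.*-zeroʳ (+ bit i)) ⟩
      0ℤ +ᶻ E (proj₂ q) (rest i)            ≡⟨ ℤ.+-identityˡ _ ⟩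
      E (proj₂ q) (rest i) ∎
      where open SetoidReasoning ≋-setoid
    same-rest : remainder {2} n i ≡ remainder {2} n j
    same-rest = selection-injective tri _ _ λ q∈ →
      ≋-trans (≋-sym (drop-head q∈ i)) (≋-trans (eq (there q∈)) (drop-head q∈ j))
    same-bit : quotient {2} n i ≡ quotient {2} n j
    same-bit = bit-injective _ _ (*-cancelˡ pr g≢0
      (≡.subst₂ _≋_ (ℤ.*-comm (+ bit i) (E c g)) (ℤ.*-comm (+ bit j) (E c g))
        (+-cancelʳ (E c (rest i)) (≡.subst₂ _≋_ (split c i)
          (≡.trans (split c j) (cong (λ r → + bit j *ᶻ E c g +ᶻ E c (concat (selection gs r))) (≡.sym same-rest)))
          (eq (here refl))))))

  -- the number 2 ^ (d (d − 1) / 2) of 0-1-valued functions on pairs below d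
  #graphs : ℕ → ℕ
  #graphs zero    = 1
  #graphs (suc d) = 2 ^ d * #graphs d

  -- The index codes a graph on the members. Its leading digit is the set of neighbours of the head
  -- `g` in the tail; since commutators are bilinear in class 2, one commutator with the product of
  -- that set carries all these edges, and one factor per member suffices.
  commutators : (gs : List Pivoted) → Fin (#graphs (length gs)) → List (Word Gen)
  commutators []             _ = []
  commutators ((g , c) ∷ gs) i =
    comm (concat (selection gs (quotient {2 ^ length gs} (#graphs (length gs)) i))) g ∷
    commutators gs (remainder {2 ^ length gs} (#graphs (length gs)) i)

  E-commutators : ∀ a (gs : List Pivoted) i → E a (concat (commutators gs i)) ≋ 0ℤ
  E-commutators a []             i = ≋-refl
  E-commutators a ((g , c) ∷ gs) i = subst (_≋ 0ℤ) (≡.sym (E-++ a (comm h g) (concat (commutators gs j))))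
    (+-cong (E-comm a h g) (E-commutators a gs j))
    where
    h = concat (selection gs (quotient {2 ^ length gs} (#graphs (length gs)) i))
    j = remainder {2 ^ length gs} (#graphs (length gs)) i

  -- At two pivots of the tail the minors involving `g` vanish, so induction recovers the graph on
  -- the tail. At a tail pivot q paired with the pivot `c` of `g`, the commutator contributes 2
  -- E_c(g) E_q(h), which determines E_q(h) and hence the neighbours of `g`.
  commutators-injective : ∀ {gs} → Tri gs → (i j : Fin (#graphs (length gs))) →
    (∀ {q r} → q ∈ gs → r ∈ gs → ω (proj₂ q) (proj₂ r) (concat (commutators gs i)) ≋
                                 ω (proj₂ q) (proj₂ r) (concat (commutators gs j))) → i ≡ j
  commutators-injective [] fzero fzero _ = refl
  commutators-injective {(g , c) ∷ gs} (cons g≢0 g≋0 tri) i j eq = combine-≡ {m} n same-selection same-rest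
    where
    m = 2 ^ length gs
    n = #graphs (length gs)
    h : Fin (m * n) → Word Gen
    h i = concat (selection gs (quotient {m} n i))
    rest : Fin (m * n) → Word Gen
    rest i = concat (commutators gs (remainder {m} n i))
    split : ∀ a b i → ω a b (comm (h i) g ++ rest i) ≋ + 2 *ᶻ minor a b (h i) g +ᶻ ω a b (rest i)
    split a b i = ≋-trans
      (ω-++-central a b (comm (h i) g) (rest i) (E-commutators a gs _) (E-commutators b gs _))
      (+-cong (ω-comm a b (h i) g) (≋-refl {ω a b (rest i)}))
    minor-vanishes : ∀ {q r} → q ∈ gs → r ∈ gs → ∀ u → minor (proj₂ q) (proj₂ r) u g ≋ 0ℤ
    minor-vanishes {_ , a} {_ , b} q∈ r∈ u = ≋-trans
      (+-cong (*-cong (≋-refl {E a u}) (g≋0 r∈)) (-‿cong (*-cong (≋-refl {E b u}) (g≋0 q∈))))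
      (≡⇒≋ (lemma (E a u) (E b u)))
      where lemma : ∀ r s → r *ᶻ 0ℤ - s *ᶻ 0ℤ ≡ 0ℤ
            lemma = solve-∀
    drop-head : ∀ {q r} → q ∈ gs → r ∈ gs → ∀ i →
                ω (proj₂ q) (proj₂ r) (comm (h i) g ++ rest i) ≋ ω (proj₂ q) (proj₂ r) (rest i)
    drop-head {q} {r} q∈ r∈ i = ≋-trans (split _ _ i) (≋-trans
      (+-cong (*-cong (≋-refl {+ 2}) (minor-vanishes q∈ r∈ (h i))) (≋-refl {ω (proj₂ q) (proj₂ r) (rest i)}))
      (≡⇒≋ (ℤ.+-identityˡ _)))
    same-rest : remainder {m} n i ≡ remainder {m} n j
    same-rest = commutators-injective tri _ _ λ q∈ r∈ →
      ≋-trans (≋-sym (drop-head q∈ r∈ i)) (≋-trans (eq (there q∈) (there r∈)) (drop-head q∈ r∈ j))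
    minor-pivot : ∀ {q} → q ∈ gs → ∀ u → minor (proj₂ q) c u g ≋ E c g *ᶻ E (proj₂ q) u
    minor-pivot {_ , a} q∈ u = ≋-trans
      (+-cong (≋-refl {E a u *ᶻ E c g}) (-‿cong (*-cong (≋-refl {E c u}) (g≋0 q∈))))
      (≡⇒≋ (lemma (E a u) (E c g) (E c u)))
      where lemma : ∀ r s t → r *ᶻ s - t *ᶻ 0ℤ ≡ s *ᶻ r
            lemma = solve-∀
    same-E : ∀ {q} → q ∈ gs → E (proj₂ q) (h i) ≋ E (proj₂ q) (h j)
    same-E {q} q∈ = *-cancelˡ pr g≢0
      (≋-trans (≋-sym (minor-pivot q∈ (h i))) (≋-trans same-minor (minor-pivot q∈ (h j))))
      where
      a = proj₂ q
      same-minor : minor a c (h i) g ≋ minor a c (h j) g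
      same-minor = *-cancelˡ pr 2≢0 (+-cancelʳ (ω a c (rest i))
        (≋-trans (≋-sym (split a c i)) (≋-trans (eq (there q∈) (here refl))
          (subst (λ s → ω a c (comm (h j) g ++ rest j) ≋
                        + 2 *ᶻ minor a c (h j) g +ᶻ ω a c (concat (commutators gs s)))
            (≡.sym same-rest) (split a c j)))))
    same-selection : quotient {m} n i ≡ quotient {m} n j
    same-selection = selection-injective tri _ _ same-E

  -- The coordinate ω at the pair (0, i+1) is 2 on y_{0,i+1} and 0 on the other y_{0,j+1}. Inverting
  -- first passes from `Y` to these y's.
  Y-injective : ∀ i j → [ Y i ] ≈ [ Y j ] → i ≡ j
  Y-injective i j eq with i ≟ j
  ... | yes i≡j = i≡j
  ... | no i≢j  = contradiction
    (≋-trans (≋-sym (≡⇒≋ at-i)) (≋-trans (ω-cong 0 (suc i) (invWord-cong eq)) (≡⇒≋ at-j))) 2≢0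
    where
    at-i : ω 0 (suc i) (invWord [ Y i ]) ≡ + 2
    at-i rewrite δ-refl i = refl
    at-j : ω 0 (suc i) (invWord [ Y j ]) ≡ 0ℤ
    at-j rewrite δ-≢ i≢j = refl

-- Numerical estimates.

n<2^n : ∀ n → n < 2 ^ n
n<2^n zero    = s≤s z≤n
n<2^n (suc n) = begin
  2 + n                  ≤⟨ s≤s (n<2^n n) ⟩
  1 + 2 ^ n              ≤⟨ +-monoˡ-≤ (2 ^ n) (≤-trans (s≤s z≤n) (n<2^n n)) ⟩
  2 ^ n + 2 ^ n          ≡⟨ cong (λ r → 2 ^ n + r) (+-identityʳ (2 ^ n)) ⟨
  2 ^ suc n ∎
  where open ≤-Reasoning

1+2n<2^n : ∀ n → 1 + 2 * (3 + n) < 2 ^ (3 + n)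
1+2n<2^n zero    = ≤-refl
1+2n<2^n (suc n) = begin
  2 + 2 * (4 + n)                 ≡⟨ lemma n ⟩
  2 + (2 + 2 * (3 + n))           ≤⟨ +-mono-≤ (≤-trans (s≤s (s≤s z≤n)) (1+2n<2^n n)) (1+2n<2^n n) ⟩
  2 ^ (3 + n) + 2 ^ (3 + n)       ≡⟨ cong (λ r → 2 ^ (3 + n) + r) (+-identityʳ _) ⟨
  2 ^ (4 + n) ∎
  where
  open ≤-Reasoning
  lemma : ∀ n → 2 + 2 * (4 + n) ≡ 2 + (2 + 2 * (3 + n))
  lemma = ℕRing.solve-∀

exponential-dominates : ∀ a b → ∃ λ m → a + m * b < 2 ^ m
-- With exponent 2 q the power splits in two: one factor 2^q exceeds 1 + 2 q, for which q ≥ 3 is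
-- needed, and the other is at least a + b.
exponential-dominates a b = q + q , (begin-strict
  a + (q + q) * b                        ≤⟨ m≤m+n _ _ ⟩
  a + (q + q) * b + (b + (q + q) * a)    ≡⟨ lemma a b q ⟩
  (1 + 2 * q) * (a + b)                  ≤⟨ *-monoʳ-≤ (1 + 2 * q) (≤-trans (m≤n+m (a + b) 3) (<⇒≤ (n<2^n q))) ⟩
  (1 + 2 * q) * 2 ^ q                    <⟨ *-monoˡ-< (2 ^ q) {{m^n≢0 2 q}} (1+2n<2^n (a + b)) ⟩
  2 ^ q * 2 ^ q                          ≡⟨ ^-distribˡ-+-* 2 q q ⟨
  2 ^ (q + q) ∎)
  where
  open ≤-Reasoning
  q = 3 + (a + b)
  lemma : ∀ a b q → a + (q + q) * b + (b + (q + q) * a) ≡ (1 + 2 * q) * (a + b)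
  lemma = ℕRing.solve-∀

triangle : ℕ → ℕ
triangle zero    = 0
triangle (suc d) = d + triangle d

triangle-double : ∀ d → triangle d + triangle d + d ≡ d * d
triangle-double zero    = refl
triangle-double (suc d) = ≡.trans (lemma d (triangle d))
  (≡.trans (cong (_+ (1 + 2 * d)) (triangle-double d)) (lemma′ d))
  where
  lemma : ∀ d t → d + t + (d + t) + (1 + d) ≡ (t + t + d) + (1 + 2 * d)
  lemma = ℕRing.solve-∀
  lemma′ : ∀ d → d * d + (1 + 2 * d) ≡ (1 + d) * (1 + d)
  lemma′ = ℕRing.solve-∀

-- With d = 2^m the right-hand side is at most k d (a + 3 c m), where `a` collects the terms free of
-- m. Twice the left-hand side is d² - d, so it suffices that d exceeds 1 + 2 k (a + 3 c m); the 1
-- accounts for the subtracted d.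
triangle-too-big : ∀ k n p c l →
  ¬ (∀ m → triangle (2 ^ m) ≤
           k * (n + 2 ^ m * ((m + p) * c + (c + c + c) + l + c) + m * c + (c + c) + m * c))
triangle-too-big k n p c l bounded = <-irrefl refl d²<d²
  where
  open ≤-Reasoning
  a = n + p * c + l + 6 * c
  m = proj₁ (exponential-dominates (1 + 2 * k * a) (2 * k * (3 * c)))
  dominates : 1 + 2 * k * a + m * (2 * k * (3 * c)) < 2 ^ m
  dominates = proj₂ (exponential-dominates (1 + 2 * k * a) (2 * k * (3 * c)))
  d = 2 ^ m
  step = (m + p) * c + (c + c + c) + l + c
  r = n + (m * c + (c + c) + m * c)
  lemma₁ : ∀ n e u v w → n + e + u + v + w ≡ (n + (u + v + w)) + e
  lemma₁ = ℕRing.solve-∀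
  lemma₂ : ∀ n m p c l → (n + (m * c + (c + c) + m * c)) + ((m + p) * c + (c + c + c) + l + c)
           ≡ n + p * c + l + 6 * c + m * (3 * c)
  lemma₂ = ℕRing.solve-∀
  lemma₃ : ∀ d k a m b → k * (d * (a + m * b)) + k * (d * (a + m * b)) + d ≡
           d * (1 + 2 * k * a + m * (2 * k * b))
  lemma₃ = ℕRing.solve-∀
  length≤ : n + d * step + m * c + (c + c) + m * c ≤ d * (a + m * (3 * c))
  length≤ = begin
    n + d * step + m * c + (c + c) + m * c ≡⟨ lemma₁ n (d * step) (m * c) (c + c) (m * c) ⟩
    r + d * step             ≡⟨ cong (_+ d * step) (*-identityˡ r) ⟨
    1 * r + d * step         ≤⟨ +-monoˡ-≤ (d * step) (*-monoˡ-≤ r (≤-trans (s≤s z≤n) (n<2^n m))) ⟩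
    d * r + d * step         ≡⟨ *-distribˡ-+ d r step ⟨
    d * (r + step)           ≡⟨ cong (d *_) (lemma₂ n m p c l) ⟩
    d * (a + m * (3 * c)) ∎
  triangle≤ : triangle d ≤ k * (d * (a + m * (3 * c)))
  triangle≤ = ≤-trans (bounded m) (*-monoʳ-≤ k length≤)
  d²<d² : d * d < d * d
  d²<d² = begin-strict
    d * d                                       ≡⟨ triangle-double d ⟨
    triangle d + triangle d + d                 ≤⟨ +-monoˡ-≤ d (+-mono-≤ triangle≤ triangle≤) ⟩
    k * (d * (a + m * (3 * c))) + k * (d * (a + m * (3 * c))) + d ≡⟨ lemma₃ d k a m (3 * c) ⟩
    d * (1 + 2 * k * a + m * (2 * k * (3 * c))) <⟨ *-monoʳ-< d {{m^n≢0 2 m}} dominates ⟩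
    d * d ∎

-- Short independent elements and the final count.

module Growth (p′ : ℕ) (pr : Prime (suc p′)) (odd : suc p′ ≢ 2) (W : LpWordAutomatic (suc p′)) where
  open Lp p′
  open Invariants p′
  open Triangular p′ pr odd
  open Automatic group W
  open WordAutomatic W using (k)
  open GroupProperties group using (inverseˡ-unique)

  #graphs≡ : ∀ d → #graphs d ≡ 2 ^ triangle d
  #graphs≡ zero    = refl
  #graphs≡ (suc d) = ≡.trans (cong (2 ^ d *_) (#graphs≡ d)) (≡.sym (^-distribˡ-+-* 2 d (triangle d)))

  long-commutator : ∀ n → ∃ λ i → n < ∣ [ Y i ] ∣
  long-commutator n with ¬∀⟶∃¬ (suc M) (λ i → ∣ [ Y (toℕ i) ] ∣ ≤ n) (λ i → ∣ [ Y (toℕ i) ] ∣ ≤? n) not-all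
    where
    M = suc k ^ n
    not-all : ¬ (∀ (i : Fin (suc M)) → ∣ [ Y (toℕ i) ] ∣ ≤ n)
    not-all short = 1+n≰n (counting (λ i → [ Y (toℕ i) ]) short (toℕ-injective ∘ Y-injective _ _))
  ... | i , long = toℕ i , ≰⇒> long

  -- In order: the product s of at most 2^(m+p) clearing factors; the commutator ψ(s) at `C + C` and
  -- its inverse at `S`, rounded up to `C`; the pumping of v; the product v s.
  cost : ℕ → ℕ
  cost m = (m + p) * C + (C + C + C) + K + C

  module _ {n} (ε≤n : ∣ [] ∣ ≤ n) (x₀≤n : ∣ x₀ ∣ ≤ n) where

    Short : Word Gen → Set
    Short g = ∣ g ∣ ≤ n

    -- `N` bounds ψ(s)⁻¹ for every product s that clearing can produce, and it is fixed before v is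
    -- chosen. Pumping gives v with ψ(v) longer than `N`; if ψ(v s) were trivial, ψ(v) would equal
    -- ψ(s)⁻¹. So v s keeps an exponent nonzero modulo p, which serves as the new pivot.
    extend : ∀ m {gs} → Tri gs → length gs ≤ 2 ^ m → (∀ {q} → q ∈ gs → Short (proj₁ q)) →
             ∃₂ λ g c → Tri ((g , c) ∷ gs) × ∣ g ∣ ≤ n + cost m
    extend m {gs} tri len short = conclude (long-commutator N)
      where
      n₁ = n + (m + p) * C
      N  = n₁ + (C + C + C)
      n≤n₁ : n ≤ n₁
      n≤n₁ = m≤m+n n _
      n₁≤N : n₁ ≤ N
      n₁≤N = m≤m+n n₁ _
      conclude : (∃ λ i → N < ∣ [ Y i ] ∣) → ∃₂ λ g c → Tri ((g , c) ∷ gs) × ∣ g ∣ ≤ n + cost m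
      conclude (i , long) with commutator-pump x₀ (≤-trans x₀≤n (≤-trans n≤n₁ n₁≤N))
                                 (gen (x (suc i))) [ Y i ] (x-commutator i) long
      ... | v , t , v-comm , v≤ , N<t = result (pivot-or-trivial (v ++ s))
        where
        open Clearing (clear-pivots {Short} tri short v)
        s = concat factors
        s≤ : ∣ s ∣ ≤ n₁
        s≤ = ∣∣-∏ ε≤n (m + p) factors
          (≤-trans bound (≤-trans (*-mono-≤ len (<⇒≤ (n<2^n p))) (≤-reflexive (≡.sym (^-distribˡ-+-* 2 m p))))) all
        ψs≤ : ∣ ψ s ∣ ≤ n₁ + (C + C)
        ψs≤ = ∣∣-comm (≤-trans ε≤n n≤n₁) s x₀ (ψ s) (ψ-commutator s) s≤ (≤-trans x₀≤n n≤n₁)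
        ψs⁻¹≤ : ∣ invWord (ψ s) ∣ ≤ N
        ψs⁻¹≤ = ≤-trans (∣∣-inv (≤-trans ε≤n (≤-trans n≤n₁ (m≤m+n n₁ _))) (ψ s) ψs≤)
          (≤-trans (+-monoʳ-≤ (n₁ + (C + C)) (m≤m+n _ _)) (≤-reflexive (+-assoc n₁ (C + C) C)))
        trivial-absurd : ¬ ψ (v ++ s) ≈ []
        trivial-absurd triv = <⇒≱ N<t (subst (_≤ N) (∣∣-cong (pe-sym t≈)) ψs⁻¹≤)
          where
          t≈ : t ≈ invWord (ψ s)
          t≈ = pe-trans (ψ-unique v t v-comm)
            (inverseˡ-unique (ψ v) (ψ s) (pe-trans (≡⇒≈ (≡.sym (ψ-++ v s))) triv))
        result : _ → ∃₂ λ g c → Tri ((g , c) ∷ gs) × ∣ g ∣ ≤ n + cost m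
        result (inj₂ triv)     = contradiction triv trivial-absurd
        result (inj₁ (c , p∤)) = v ++ s , c , cons (p∤ ∘ E≋0⇒∣ c (v ++ s)) cleared tri ,
          (begin
            ∣ v ++ s ∣    ≤⟨ ∣∣-∙ (≤-trans ε≤n (≤-trans n≤n₁ (≤-trans n₁≤N (m≤m+n N K)))) v s v≤
                               (≤-trans s≤ (≤-trans n₁≤N (m≤m+n N K))) ⟩
            N + K + C     ≡⟨ lemma n ((m + p) * C) (C + C + C) K C ⟩
            n + cost m ∎)
          where
          open ≤-Reasoning
          lemma : ∀ n a b k c → n + a + b + k + c ≡ n + (a + b + k + c)
          lemma = ℕRing.solve-∀

    selection-factors : ∀ {gs} → (∀ {q} → q ∈ gs → Short (proj₁ q)) → ∀ i →
                        All Short (selection gs i) × length (selection gs i) ≤ length gs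
    selection-factors {[]}           short i = [] , z≤n
    selection-factors {(g , c) ∷ gs} short i
      with quotient {2} (2 ^ length gs) i
         | selection-factors {gs} (short ∘ there) (remainder {2} (2 ^ length gs) i)
    ... | fzero      | all , len = all , m≤n⇒m≤1+n len
    ... | fsuc fzero | all , len = short (here refl) ∷ all , s≤s len

    commutators-factors : ∀ m {gs} → length gs ≤ 2 ^ m → (∀ {q} → q ∈ gs → Short (proj₁ q)) → ∀ i →
                          All (λ g → ∣ g ∣ ≤ n + m * C + (C + C)) (commutators gs i) ×
                          length (commutators gs i) ≡ length gs
    commutators-factors m {[]}           len short i = [] , refl
    commutators-factors m {(g , c) ∷ gs} len short i
      with commutators-factors m {gs} (≤-trans (n≤1+n _) len) (short ∘ there)
             (remainder {2 ^ length gs} (#graphs (length gs)) i)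
    ... | all , eq = ∣∣-comm (≤-trans ε≤n (m≤m+n n _)) h g (comm h g) (commutator h g) h≤
                       (≤-trans (short (here refl)) (m≤m+n n _)) ∷ all , cong suc eq
      where
      j = quotient {2 ^ length gs} (#graphs (length gs)) i
      h = concat (selection gs j)
      h≤ : ∣ h ∣ ≤ n + m * C
      h≤ = ∣∣-∏ ε≤n m (selection gs j)
        (≤-trans (proj₂ (selection-factors (short ∘ there) j)) (≤-trans (n≤1+n _) len))
        (proj₁ (selection-factors (short ∘ there) j))

    -- The three increments in the exponent pay for the product of the neighbours, its commutator
    -- with the member, and the product of all these commutators.
    graphs-bound : ∀ m {gs} → Tri gs → length gs ≤ 2 ^ m → (∀ {q} → q ∈ gs → Short (proj₁ q)) →
                   #graphs (length gs) ≤ suc k ^ (n + m * C + (C + C) + m * C)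
    graphs-bound m {gs} tri len short = counting (λ i → concat (commutators gs i))
      (λ i → ∣∣-∏ (≤-trans ε≤n (≤-trans (m≤m+n n _) (m≤m+n _ _))) m (commutators gs i)
        (≤-trans (≤-reflexive (proj₂ (commutators-factors m len short i))) len)
        (proj₁ (commutators-factors m len short i)))
      (λ {i} {j} eq → commutators-injective tri i j λ {q} {r} _ _ → ω-cong (proj₂ q) (proj₂ r) eq)

  n₀ : ℕ
  n₀ = ∣ [] ∣ + ∣ x₀ ∣

  ε≤ : ∀ n → ∣ [] ∣ ≤ n₀ + n
  ε≤ n = m≤n⇒m≤n+o n (m≤m+n ∣ [] ∣ ∣ x₀ ∣)

  x₀≤ : ∀ n → ∣ x₀ ∣ ≤ n₀ + n
  x₀≤ n = m≤n⇒m≤n+o n (m≤n+m ∣ x₀ ∣ ∣ [] ∣)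

  record Family (n d : ℕ) : Set where
    field
      members    : List Pivoted
      triangular : Tri members
      size       : length members ≡ d
      short      : ∀ {q} → q ∈ members → ∣ proj₁ q ∣ ≤ n

  family-extend : ∀ m n {d} → d ≤ 2 ^ m → Family (n₀ + n) d → Family (n₀ + n + cost m) (suc d)
  family-extend m n d≤ F = insert (extend (ε≤ n) (x₀≤ n) m triangular (≤-trans (≤-reflexive size) d≤) short)
    where
    open Family F
    insert : (∃₂ λ g c → Tri ((g , c) ∷ members) × ∣ g ∣ ≤ n₀ + n + cost m) → Family (n₀ + n + cost m) _
    insert (g , c , tri , g≤) = record
      { members = (g , c) ∷ members ; triangular = tri ; size = cong suc size
      ; short = λ { (here refl) → g≤ ; (there q∈) → m≤n⇒m≤n+o (cost m) (short q∈) } }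

  family : ∀ m d → d ≤ 2 ^ m → Family (n₀ + d * cost m) d
  family m zero    _  = record { members = [] ; triangular = [] ; size = refl ; short = λ () }
  family m (suc d) d< = subst (λ n → Family n (suc d)) eq
    (family-extend m (d * cost m) (<⇒≤ d<) (family m d (<⇒≤ d<)))
    where
    eq : n₀ + d * cost m + cost m ≡ n₀ + suc d * cost m
    eq = ≡.trans (+-assoc n₀ (d * cost m) (cost m)) (cong (λ r → n₀ + r) (+-comm (d * cost m) (cost m)))

  triangle-bound : ∀ m → let d = 2 ^ m in
                   triangle d ≤ k * (n₀ + d * cost m + m * C + (C + C) + m * C)
  triangle-bound m = ≮⇒≥ λ L<T → <⇒≱ (^-monoʳ-< 2 ≤-refl L<T) (begin
      2 ^ triangle d                     ≡⟨ cong (λ l → 2 ^ triangle l) size ⟨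
      2 ^ triangle (length members)      ≡⟨ #graphs≡ (length members) ⟨
      #graphs (length members)           ≤⟨ graphs-bound (ε≤ (d * cost m)) (x₀≤ (d * cost m)) m
                                              triangular (≤-reflexive size) short ⟩
      -- Passing to base 2 by k + 1 ≤ 2^k reduces the comparison to exponents.
      suc k ^ L                          ≤⟨ ^-monoˡ-≤ L (n<2^n k) ⟩
      (2 ^ k) ^ L                        ≡⟨ ^-*-assoc 2 k L ⟩
      2 ^ (k * L) ∎)
    where
    open ≤-Reasoning
    d = 2 ^ m
    L = n₀ + d * cost m + m * C + (C + C) + m * C
    open Family (family m d ≤-refl)

  impossible : ⊥
  impossible = triangle-too-big k n₀ p C K triangle-bound

mainTheorem1 : (p : ℕ) → Prime p → p ≢ 2 → ¬ LpWordAutomatic p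
mainTheorem1 zero     pr _   _ = ¬prime[0] pr
mainTheorem1 (suc p′) pr odd W = Growth.impossible p′ pr odd W
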